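{- Let $G$ and $H$ be connected graphs of order $n\ge2$ and $m\ge2$, respectively, each of which is either chordal or a cycle graph. If $G$ is just a frame graph in the spaces of dimension $n',n'+1,\dots,n$ and $H$ is just a frame graph in the spaces of dimension $m',m'+1,\dots,m$, then the corona product $G\circ H$ is just a frame graph in the spaces of dimension $nm'+n',nm'+n'+1,\dots,nm+n-1,nm+n$.
   Context: All graphs are finite and simple. A finite frame for a finite-dimensional inner product space $\mathcal{H}$ over $\mathbb{R}$ or $\mathbb{C}$ is a finite sequence $\varphi=(f_i)_{i=1}^N$ in $\mathcal{H}$ for which there are constants $0<A\le B<\infty$ with $A\|f\|^2\le\sum_{i=1}^N|\langle f,f_i\rangle|^2\le B\|f\|^2$ for all $f\in\mathcal{H}$ (equivalently, a finite sequence spanning $\mathcal{H}$; repeated vectors are allowed and count as different vertices). Its frame graph $G(\varphi)$ has the elements $f_1,\dots,f_N$ of the sequence as vertices, and for $i\ne j$, $f_i$ and $f_j$ are adjacent iff $\langle f_i,f_j\rangle\ne 0$. A graph $G$ is a frame graph in $\mathcal{H}$ if there is a finite frame $\varphi$ for $\mathcal{H}$ with $G(\varphi)=G$ (up to labelling of vertices). "$G$ is just a frame graph in the spaces of dimension $a,a+1,\dots,b$" means: for each $\mathbb{F}\in\{\mathbb{R},\mathbb{C}\}$ and each integer $d\ge1$, $G$ is a frame graph in a $d$-dimensional inner product space over $\mathbb{F}$ if and only if $a\le d\le b$. A graph is chordal if it has no induced cycle $C_r$ with $r\ge4$. The corona product $G_1\circ G_2$ of $G_1=(V_1,E_1)$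 with $G_2=(V_2,E_2)$ is the graph of order $|V_1||V_2|+|V_1|$ obtained by taking one copy of $G_1$ and $|V_1|$ copies of $G_2$, and joining every vertex of the $i$th copy of $G_2$ to the $i$th vertex of $G_1$. -}

module Defs where

open import Algebra.Bundles using (CommutativeRing; AbelianGroup)
open import Algebra.Construct.DirectProduct using () renaming (abelianGroup to ×-abelianGroup)
import Algebra.Consequences.Setoid as Consequences
open import Algebra.Core using (Op₁; Op₂)
open import Algebra.Definitions
import Algebra.Definitions.RawMonoid as RawMonoidDefs
open import Algebra.Module.Bundles using (LeftModule)
import Algebra.Properties.Ring as RingProperties
import Algebra.Solver.Ring.NaturalCoefficients.Default as SemiringSolver
open import Data.Fin.Base using (Fin; toℕ)
import Data.Fin.Properties as Fin
open import Data.Nat.Base as ℕ using (ℕ; suc)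
import Data.Nat.DivMod as ℕ
import Data.Nat.Properties as ℕ
open import Data.Product.Base using (Σ-syntax; ∃-syntax; _×_; _,_; proj₁)
open import Data.Product.Relation.Binary.Pointwise.NonDependent using (×-decidable)
open import Data.Sum.Base using (_⊎_; inj₁; inj₂; swap)
open import Function.Base using (id)
open import Function.Bundles using (_⇔_; _↔_; _↣_; Inverse; Injection)
open import Level using (0ℓ)
open import Relation.Binary.Construct.Closure.ReflexiveTransitive using (Star)
open import Relation.Binary.Core using (Rel)
open import Relation.Binary.Definitions using (Decidable; Symmetric)
open import Relation.Binary.PropositionalEquality using (_≡_; _≢_; refl; sym; trans; cong)
import Relation.Binary.Reasoning.Setoid as ≈-Reasoning
open import Relation.Binary.Structures using (IsDecTotalOrder)
open import Relation.Nullary using (¬_; yes; no)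
open import Relation.Nullary.Decidable using (¬?; _×-dec_; _⊎-dec_)
open import Relation.Unary using (Pred; Satisfiable)

------------------------------------------------------------------------
-- Graphs

record Graph (V : Set) : Set₁ where
  infix 4 _~_ _~?_
  field
    _~_    : Rel V 0ℓ
    ~-sym  : Symmetric _~_
    ~-irr  : ∀ {u} → ¬ (u ~ u)
    _~?_   : Decidable _~_

open Graph using () renaming (_~_ to Adj)

infix 4 _≅_

_≅_ : {V W : Set} → Graph V → Graph W → Set
_≅_ {V} {W} G H = Σ[ f ∈ V ↔ W ]
  (∀ u v → Adj G u v ⇔ Adj H (Inverse.to f u) (Inverse.to f v))

HasInducedCopyOf : {V W : Set} → Graph W → Graph V → Set
HasInducedCopyOf {V} {W} H G = Σ[ f ∈ V ↣ W ]
  (∀ u v → Adj G u v ⇔ Adj H (Injection.to f u) (Injection.to f v))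

Connected : {V : Set} → Graph V → Set
Connected G = ∀ u v → Star (Adj G) u v

-- The shift by 3 leaves out the degenerate cases: cycle k is C_{3+k}.
cycle : (k : ℕ) → Graph (Fin (3 ℕ.+ k))
cycle k = record
  { _~_   = λ i j → next i j ⊎ next j i
  ; ~-sym = swap
  ; ~-irr = λ { (inj₁ p) → irr p ; (inj₂ p) → irr p }
  ; _~?_  = λ i j → next? i j ⊎-dec next? j i
  }
  where
  r = 3 ℕ.+ k

  next : Rel (Fin r) 0ℓ
  next i j = suc (toℕ i) ℕ.% r ≡ toℕ j

  next? : Decidable next
  next? i j = suc (toℕ i) ℕ.% r ℕ.≟ toℕ j

  irr : ∀ {i} → ¬ next i i
  irr {i} p with suc (toℕ i) ℕ.<? r
  ... | yes i+1<r = ℕ.1+n≢n (trans (sym (ℕ.m<n⇒m%n≡m i+1<r)) p)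
  ... | no  i+1≮r = ℕ.0≢1+n (trans 0≡i (ℕ.suc-injective i+1≡r))
    where
    i+1≡r : suc (toℕ i) ≡ r
    i+1≡r = ℕ.≤-antisym (Fin.toℕ<n i) (ℕ.≮⇒≥ i+1≮r)
    0≡i : 0 ≡ toℕ i
    0≡i = trans (sym (ℕ.n%n≡0 r)) (trans (cong (ℕ._% r) (sym i+1≡r)) p)

IsCycle : {V : Set} → Graph V → Set
IsCycle G = ∃[ k ] (cycle k ≅ G)

Chordal : {V : Set} → Graph V → Set
Chordal G = ∀ k → ¬ HasInducedCopyOf G (cycle (suc k))

-- inj₁ i is the i-th vertex of G, and inj₂ (i , x) is the vertex x of the
-- i-th copy of H.
corona : ∀ {n m} → Graph (Fin n) → Graph (Fin m) → Graph (Fin n ⊎ (Fin n × Fin m))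
corona {n} {m} G H = record
  { _~_   = _~_
  ; ~-sym = λ {u} {v} → ~-sym u v
  ; ~-irr = λ {u} → ~-irr u
  ; _~?_  = _~?_
  }
  where
  module G = Graph G
  module H = Graph H

  _~_ : Rel (Fin n ⊎ (Fin n × Fin m)) 0ℓ
  inj₁ i       ~ inj₁ j       = i G.~ j
  inj₁ i       ~ inj₂ (j , _) = i ≡ j
  inj₂ (i , _) ~ inj₁ j       = i ≡ j
  inj₂ (i , x) ~ inj₂ (j , y) = i ≡ j × x H.~ y

  ~-sym : ∀ u v → u ~ v → v ~ u
  ~-sym (inj₁ _) (inj₁ _) p       = G.~-sym p
  ~-sym (inj₁ _) (inj₂ _) p       = sym p
  ~-sym (inj₂ _) (inj₁ _) p       = sym p
  ~-sym (inj₂ _) (inj₂ _) (p , q) = sym p , H.~-sym q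

  ~-irr : ∀ u → ¬ (u ~ u)
  ~-irr (inj₁ _) p       = G.~-irr p
  ~-irr (inj₂ _) (_ , q) = H.~-irr q

  _~?_ : Decidable _~_
  inj₁ i       ~? inj₁ j       = i G.~? j
  inj₁ i       ~? inj₂ (j , _) = i Fin.≟ j
  inj₂ (i , _) ~? inj₁ j       = i Fin.≟ j
  inj₂ (i , x) ~? inj₂ (j , y) = (i Fin.≟ j) ×-dec (x H.~? y)

------------------------------------------------------------------------
-- Scalars

-- The real numbers, characterised up to isomorphism as the Dedekind-complete
-- ordered field.  As usual classically, the order is decidable.
record CompleteOrderedField : Set₁ where
  field
    commutativeRing : CommutativeRing 0ℓ 0ℓ

  open CommutativeRing commutativeRing public

  infix 4 _≤_ _<_
  field
    _≤_             : Rel Carrier 0ℓ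
    isDecTotalOrder : IsDecTotalOrder _≈_ _≤_
    +-monoʳ-≤       : ∀ z {x y} → x ≤ y → z + x ≤ z + y
    *-nonNeg        : ∀ {x y} → 0# ≤ x → 0# ≤ y → 0# ≤ x * y
    0#≉1#           : 0# ≉ 1#
    inverse         : ∀ x → x ≉ 0# → ∃[ y ] x * y ≈ 1#

  _<_ : Rel Carrier 0ℓ
  x < y = x ≤ y × x ≉ y

  UpperBound : Pred Carrier 0ℓ → Pred Carrier 0ℓ
  UpperBound P b = ∀ x → P x → x ≤ b

  field
    supremum : (P : Pred Carrier 0ℓ) → Satisfiable P → Satisfiable (UpperBound P) →
               ∃[ s ] (UpperBound P s × (∀ b → UpperBound P b → s ≤ b))

data 𝔽 : Set where
  real complex : 𝔽

module _ (ℝ : CompleteOrderedField) where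

  private module ℝ = CompleteOrderedField ℝ

  module ℂ where

    open ℝ using (_+_; _*_; _-_; -_; 0#; 1#; _≈_)
    open RingProperties ℝ.ring using (-0#≈0#; -1*x≈-x)
    open ≈-Reasoning ℝ.setoid
    open SemiringSolver ℝ.commutativeSemiring using (solve; _:+_; _:*_; _:=_)

    infixl 7 _*ᶜ_

    +-abelianGroup : AbelianGroup 0ℓ 0ℓ
    +-abelianGroup = ×-abelianGroup ℝ.+-abelianGroup ℝ.+-abelianGroup

    private module + = AbelianGroup +-abelianGroup

    _*ᶜ_ : Op₂ +.Carrier
    (a , b) *ᶜ (c , d) = a * c - b * d , a * d + b * c

    1ᶜ : +.Carrier
    1ᶜ = 1# , 0#

    conjᶜ : Op₁ +.Carrier
    conjᶜ (a , b) = a , - b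

    private

      neg : ∀ x → - x ≈ - 1# * x
      neg x = ℝ.sym (-1*x≈-x x)

      *-cong : Congruent₂ +._≈_ _*ᶜ_
      *-cong (p , q) (r , s) =
        ℝ.+-cong (ℝ.*-cong p r) (ℝ.-‿cong (ℝ.*-cong q s)) ,
        ℝ.+-cong (ℝ.*-cong p s) (ℝ.*-cong q r)

      *-comm : Commutative +._≈_ _*ᶜ_
      *-comm (a , b) (c , d) =
        ℝ.+-cong (ℝ.*-comm a c) (ℝ.-‿cong (ℝ.*-comm b d)) ,
        solve 4 (λ a b c d → a :* d :+ b :* c := c :* b :+ d :* a) ℝ.refl a b c d

      *-assoc : Associative +._≈_ _*ᶜ_
      *-assoc (a , b) (c , d) (e , f) = (begin
        (a * c - b * d) * e - (a * d + b * c) * f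
          ≈⟨ ℝ.+-cong (ℝ.*-congʳ (ℝ.+-congˡ (neg _))) (neg _) ⟩
        (a * c + - 1# * (b * d)) * e + - 1# * ((a * d + b * c) * f)
          ≈⟨ solve 7 (λ a b c d e f n →
               (a :* c :+ n :* (b :* d)) :* e :+ n :* ((a :* d :+ b :* c) :* f) :=
               a :* (c :* e :+ n :* (d :* f)) :+ n :* (b :* (c :* f :+ d :* e)))
               ℝ.refl a b c d e f (- 1#) ⟩
        a * (c * e + - 1# * (d * f)) + - 1# * (b * (c * f + d * e))
          ≈⟨ ℝ.+-cong (ℝ.*-congˡ (ℝ.+-congˡ (neg _))) (neg _) ⟨
        a * (c * e - d * f) - b * (c * f + d * e) ∎) , (begin
        (a * c - b * d) * f + (a * d + b * c) * e
          ≈⟨ ℝ.+-congʳ (ℝ.*-congʳ (ℝ.+-congˡ (neg _))) ⟩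
        (a * c + - 1# * (b * d)) * f + (a * d + b * c) * e
          ≈⟨ solve 7 (λ a b c d e f n →
               (a :* c :+ n :* (b :* d)) :* f :+ (a :* d :+ b :* c) :* e :=
               a :* (c :* f :+ d :* e) :+ b :* (c :* e :+ n :* (d :* f)))
               ℝ.refl a b c d e f (- 1#) ⟩
        a * (c * f + d * e) + b * (c * e + - 1# * (d * f))
          ≈⟨ ℝ.+-congˡ (ℝ.*-congˡ (ℝ.+-congˡ (neg _))) ⟨
        a * (c * f + d * e) + b * (c * e - d * f) ∎)

      *-identityˡ : LeftIdentity +._≈_ 1ᶜ _*ᶜ_
      *-identityˡ (a , b) = (begin
        1# * a - 0# * b  ≈⟨ ℝ.+-cong (ℝ.*-identityˡ a) (ℝ.-‿cong (ℝ.zeroˡ b)) ⟩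
        a - 0#           ≈⟨ ℝ.+-congˡ -0#≈0# ⟩
        a + 0#           ≈⟨ ℝ.+-identityʳ a ⟩
        a ∎) , (begin
        1# * b + 0# * a  ≈⟨ ℝ.+-cong (ℝ.*-identityˡ b) (ℝ.zeroˡ a) ⟩
        b + 0#           ≈⟨ ℝ.+-identityʳ b ⟩
        b ∎)

      distribˡ : _DistributesOverˡ_ +._≈_ _*ᶜ_ +._∙_
      distribˡ (a , b) (c , d) (e , f) = (begin
        a * (c + e) - b * (d + f)
          ≈⟨ ℝ.+-congˡ (neg _) ⟩
        a * (c + e) + - 1# * (b * (d + f))
          ≈⟨ solve 7 (λ a b c d e f n →
               a :* (c :+ e) :+ n :* (b :* (d :+ f)) :=
               (a :* c :+ n :* (b :* d)) :+ (a :* e :+ n :* (b :* f)))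
               ℝ.refl a b c d e f (- 1#) ⟩
        (a * c + - 1# * (b * d)) + (a * e + - 1# * (b * f))
          ≈⟨ ℝ.+-cong (ℝ.+-congˡ (neg _)) (ℝ.+-congˡ (neg _)) ⟨
        (a * c - b * d) + (a * e - b * f) ∎) ,
        solve 6 (λ a b c d e f →
          a :* (d :+ f) :+ b :* (c :+ e) :=
          (a :* d :+ b :* c) :+ (a :* f :+ b :* e))
          ℝ.refl a b c d e f

    commutativeRing : CommutativeRing 0ℓ 0ℓ
    commutativeRing = record
      { Carrier = +.Carrier
      ; _≈_ = +._≈_
      ; _+_ = +._∙_
      ; _*_ = _*ᶜ_
      ; -_  = +._⁻¹
      ; 0#  = +.ε
      ; 1#  = 1ᶜ
      ; isCommutativeRing = record
        { isRing = record
          { +-isAbelianGroup = +.isAbelianGroup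
          ; *-cong           = *-cong
          ; *-assoc          = *-assoc
          ; *-identity       = comm∧idˡ⇒id *-comm *-identityˡ
          ; distrib          = comm∧distrˡ⇒distr +.∙-cong *-comm distribˡ
          }
        ; *-comm = *-comm
        }
      }
      where open Consequences +.setoid using (comm∧idˡ⇒id; comm∧distrˡ⇒distr)

    conjᶜ-cong : Congruent₁ +._≈_ conjᶜ
    conjᶜ-cong (p , q) = p , ℝ.-‿cong q

    conjᶜ-0# : +._≈_ (conjᶜ +.ε) +.ε
    conjᶜ-0# = ℝ.refl , -0#≈0#

  -- Only the two fields below are ever used as scalars.
  record Scalars : Set₁ where
    field
      commutativeRing : CommutativeRing 0ℓ 0ℓ

    open CommutativeRing commutativeRing public

    infix 4 _≟_
    field
      _≟_       : Decidable _≈_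
      conj      : Op₁ Carrier
      conj-cong : Congruent₁ _≈_ conj
      conj-0#   : conj 0# ≈ 0#
      re        : Carrier → ℝ.Carrier

    ∣_∣² : Carrier → ℝ.Carrier
    ∣ z ∣² = re (z * conj z)

  scalars : 𝔽 → Scalars
  scalars real = record
    { commutativeRing = ℝ.commutativeRing
    ; _≟_       = IsDecTotalOrder._≟_ ℝ.isDecTotalOrder
    ; conj      = id
    ; conj-cong = id
    ; conj-0#   = ℝ.refl
    ; re        = id
    }
  scalars complex = record
    { commutativeRing = ℂ.commutativeRing
    ; _≟_       = ×-decidable (IsDecTotalOrder._≟_ ℝ.isDecTotalOrder)
                              (IsDecTotalOrder._≟_ ℝ.isDecTotalOrder)
    ; conj      = ℂ.conjᶜ
    ; conj-cong = ℂ.conjᶜ-cong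
    ; conj-0#   = ℂ.conjᶜ-0#
    ; re        = proj₁
    }

------------------------------------------------------------------------
-- Frames

  record InnerProductSpace (K : Scalars) : Set₁ where
    private module K = Scalars K

    field
      leftModule : LeftModule K.ring 0ℓ 0ℓ

    open LeftModule leftModule public

    field
      ⟨_,_⟩       : Carrierᴹ → Carrierᴹ → K.Carrier
      ⟨⟩-cong     : ∀ {x x′ y y′} → x ≈ᴹ x′ → y ≈ᴹ y′ → ⟨ x , y ⟩ K.≈ ⟨ x′ , y′ ⟩
      ⟨⟩-+ˡ       : ∀ x y z → ⟨ x +ᴹ y , z ⟩ K.≈ ⟨ x , z ⟩ K.+ ⟨ y , z ⟩
      ⟨⟩-*ˡ       : ∀ c x y → ⟨ c *ₗ x , y ⟩ K.≈ c K.* ⟨ x , y ⟩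
      ⟨⟩-conj     : ∀ x y → ⟨ y , x ⟩ K.≈ K.conj ⟨ x , y ⟩
      ⟨⟩-nonNeg   : ∀ x → ℝ.0# ℝ.≤ K.re ⟨ x , x ⟩
      ⟨⟩-definite : ∀ x → ⟨ x , x ⟩ K.≈ K.0# → x ≈ᴹ 0ᴹ

    ∥_∥² : Carrierᴹ → ℝ.Carrier
    ∥ x ∥² = K.re ⟨ x , x ⟩

    open RawMonoidDefs +ᴹ-rawMonoid public using () renaming (sum to sumᴹ)

    record IsBasis {d} (e : Fin d → Carrierᴹ) : Set where
      field
        linearlyIndependent : ∀ (c : Fin d → K.Carrier) →
                              sumᴹ (λ k → c k *ₗ e k) ≈ᴹ 0ᴹ → ∀ k → c k K.≈ K.0#
        spanning            : ∀ x → Σ[ c ∈ (Fin d → K.Carrier) ] x ≈ᴹ sumᴹ (λ k → c k *ₗ e k)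

    HasDimension : ℕ → Set
    HasDimension d = Σ[ e ∈ (Fin d → Carrierᴹ) ] IsBasis e

    open RawMonoidDefs ℝ.+-rawMonoid using (sum)

    IsFrame : ∀ {N} → (Fin N → Carrierᴹ) → Set
    IsFrame φ = ∃[ A ] ∃[ B ] (ℝ.0# ℝ.< A) × (A ℝ.≤ B) × (∀ f →
      (A ℝ.* ∥ f ∥² ℝ.≤ sum (λ i → K.∣ ⟨ f , φ i ⟩ ∣²)) ×
      (sum (λ i → K.∣ ⟨ f , φ i ⟩ ∣²) ℝ.≤ B ℝ.* ∥ f ∥²))

    frameGraph : ∀ {N} → (Fin N → Carrierᴹ) → Graph (Fin N)
    frameGraph φ = record
      { _~_   = λ i j → i ≢ j × ⟨ φ i , φ j ⟩ K.≉ K.0#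
      ; ~-sym = λ {i} {j} (i≢j , p) → (λ j≡i → i≢j (sym j≡i)) , λ q → p
                  (K.trans (⟨⟩-conj (φ j) (φ i)) (K.trans (K.conj-cong q) K.conj-0#))
      ; ~-irr = λ (i≢i , _) → i≢i refl
      ; _~?_  = λ i j → ¬? (i Fin.≟ j) ×-dec ¬? (⟨ φ i , φ j ⟩ K.≟ K.0#)
      }

  IsFrameGraph : Scalars → ℕ → {V : Set} → Graph V → Set₁
  IsFrameGraph K d G =
    Σ[ ℋ ∈ InnerProductSpace K ] let open InnerProductSpace ℋ in
      HasDimension d ×
      (∃[ N ] Σ[ φ ∈ (Fin N → Carrierᴹ) ] IsFrame φ × frameGraph φ ≅ G)

  -- "In the spaces of dimension a, a+1, …, b" refers to a nonempty list of
  -- positive dimensions, hence the first two conditions.  Without 1 ≤ a the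
  -- values 0 and 1 of a could not be told apart.
  IsJustFrameGraph : {V : Set} → Graph V → ℕ → ℕ → Set₁
  IsJustFrameGraph G a b =
    1 ℕ.≤ a × a ℕ.≤ b ×
    (∀ 𝕂 d → 1 ℕ.≤ d → IsFrameGraph (scalars 𝕂) d G ⇔ (a ℕ.≤ d × d ℕ.≤ b))

{-# OPTIONS --safe #-}

-- A frame representing G ∘ H splits orthogonally.  Let W i be the span of the
-- i-th copy of H; these spans are mutually orthogonal, and each W i carries a
-- frame with graph H.  Projecting the vector g i of the i-th vertex of G to the
-- complement of ⨁ W only subtracts an element of W i, which changes no inner
-- product ⟨ g i , g j ⟩ with i ≠ j, so the projections form a frame with graph G
-- of their span.  Hence the dimension is at least n m' + n'.
-- Conversely, add up orthogonally one frame of G and n frames of H, all of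
-- arbitrary admissible dimensions, and correct g i by a vector of the i-th
-- summand for H that is orthogonal to no vector of the frame there.  The sums of
-- admissible dimensions fill the whole interval.

module Submission where

open import Defs
open import Algebra.Bundles using (CommutativeMonoid; CommutativeRing)
open import Algebra.Definitions.RawMonoid using () renaming (sum to sumOf)
import Algebra.Definitions.RawMonoid as RawMonoidDefs
import Algebra.Module.Construct.DirectProduct as DirectProduct
import Algebra.Module.Construct.Zero as Zero
import Algebra.Properties.CommutativeMonoid.Sum as SumProperties
import Algebra.Properties.CommutativeSemigroup as CommutativeSemigroupProperties
import Algebra.Properties.Ring as RingProperties
import Algebra.Solver.Ring.NaturalCoefficients.Default as SemiringSolver
open import Data.Empty using (⊥-elim)
open import Data.Fin.Base using (Fin; zero; suc; punchIn)
import Data.Fin.Properties as Fin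
open import Data.Nat.Base as ℕ using (ℕ)
import Data.Nat.Properties as ℕ
open import Data.Product.Base using (Σ-syntax; ∃-syntax; _×_; _,_; proj₁; proj₂; uncurry)
open import Data.Sum.Algebra using (⊎-comm)
open import Data.Sum.Base using (_⊎_; inj₁; inj₂)
open import Data.Sum.Function.Propositional using (_⊎-↔_)
open import Data.Vec.Functional using (_∷_; insertAt)
import Data.Vec.Functional.Properties as Vector
open import Function.Base using (_∘_)
open import Function.Bundles
  using (_↔_; _⇔_; Inverse; Injection; Equivalence; mk⇔; mk↔ₛ′)
open import Function.Construct.Composition using (_↔-∘_)
open import Function.Construct.Identity using (↔-id)
open import Function.Properties.Inverse using (↔⇒↣)
open import Relation.Binary.Bundles using (Poset)
open import Relation.Binary.Construct.Closure.ReflexiveTransitive using (Star; ε; _◅_)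
open import Relation.Binary.PropositionalEquality as ≡ using (_≡_; _≢_)
import Relation.Binary.Reasoning.PartialOrder as ≤-Reasoning
import Relation.Binary.Reasoning.Setoid as ≈-Reasoning
open import Relation.Binary.Structures using (IsDecTotalOrder)
open import Relation.Nullary using (Dec; ¬_; yes; no)
open import Relation.Nullary.Decidable using (¬?; decidable-stable)

-- Frame bounds matter only at the interface: in finite dimension the frames are exactly the
-- spanning sequences, so the argument concerns spanning families whose pattern of non-orthogonality
-- is prescribed. Real and complex scalars are handled at once through a common interface. The
-- hypotheses on `G` and `H` speak of positive dimensions only, so the spans found inside a frame of
-- the corona must be shown nontrivial. Edges do this: a connected graph on at least two vertices
-- has one at every vertex, and adjacent vertices carry nonzero vectors. The same fact makes the
-- correcting vectors possible. Being orthogonal to no vector of a frame for `H` requires all those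
-- vectors to be nonzero; then finitely many proper subspaces have to be avoided, which infinitely
-- many scalars permit. The correction is harmless on both counts: corrections for distinct vertices
-- of `G` lie in orthogonal summands, so adjacency within `G` is unchanged, and each lies in the
-- span of its copy of `H`, so it can be subtracted again and the family still spans. The upper end
-- of the interval is the number of vertices, which bounds the dimension of whatever they span.

-- Arithmetic and finite sums in an ordered field

module OrderedField (ℝ : CompleteOrderedField) where

  open CompleteOrderedField ℝ hiding (zero)
  open IsDecTotalOrder isDecTotalOrder public
    using (_≟_; total; antisym; isPartialOrder)
    renaming (refl to ≤-refl; reflexive to ≤-reflexive; trans to ≤-trans)
  open RingProperties ring
  open RawMonoidDefs +-rawMonoid public using (sum)

  poset : Poset _ _ _
  poset = record { isPartialOrder = isPartialOrder }

  open ≤-Reasoning poset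

  +-mono-≤ : ∀ {x y u v} → x ≤ y → u ≤ v → x + u ≤ y + v
  +-mono-≤ {x} {y} {u} {v} x≤y u≤v = begin
    x + u  ≤⟨ +-monoʳ-≤ x u≤v ⟩
    x + v  ≈⟨ +-comm x v ⟩
    v + x  ≤⟨ +-monoʳ-≤ v x≤y ⟩
    v + y  ≈⟨ +-comm v y ⟩
    y + v  ∎

  +-nonNeg : ∀ {x y} → 0# ≤ x → 0# ≤ y → 0# ≤ x + y
  +-nonNeg {x} {y} 0≤x 0≤y = begin
    0#       ≈⟨ +-identityˡ 0# ⟨
    0# + 0#  ≤⟨ +-mono-≤ 0≤x 0≤y ⟩
    x + y    ∎

  x≤x+y : ∀ {x y} → 0# ≤ y → x ≤ x + y
  x≤x+y {x} {y} 0≤y = begin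
    x       ≈⟨ +-identityʳ x ⟨
    x + 0#  ≤⟨ +-monoʳ-≤ x 0≤y ⟩
    x + y   ∎

  y≤x+y : ∀ {x y} → 0# ≤ x → y ≤ x + y
  y≤x+y {x} {y} 0≤x = ≤-trans (x≤x+y 0≤x) (≤-reflexive (+-comm y x))

  -‿anti-≤ : ∀ {x y} → x ≤ y → - y ≤ - x
  -‿anti-≤ {x} {y} x≤y = begin
    - y              ≈⟨ +-identityʳ (- y) ⟨
    - y + 0#         ≈⟨ +-congˡ (-‿inverseʳ x) ⟨
    - y + (x - x)    ≈⟨ +-assoc _ _ _ ⟨
    (- y + x) - x    ≈⟨ +-comm _ _ ⟩
    - x + (- y + x)  ≤⟨ +-monoʳ-≤ (- x) (+-monoʳ-≤ (- y) x≤y) ⟩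
    - x + (- y + y)  ≈⟨ +-congˡ (-‿inverseˡ y) ⟩
    - x + 0#         ≈⟨ +-identityʳ (- x) ⟩
    - x              ∎

  *-monoʳ-≤ : ∀ {z x y} → 0# ≤ z → x ≤ y → z * x ≤ z * y
  *-monoʳ-≤ {z} {x} {y} 0≤z x≤y = begin
    z * x                  ≤⟨ x≤x+y (*-nonNeg 0≤z 0≤y-x) ⟩
    z * x + z * (y - x)    ≈⟨ distribˡ z x (y - x) ⟨
    z * (x + (y - x))      ≈⟨ *-congˡ (trans (sym (+-assoc x y (- x))) (xyx⁻¹≈y x y)) ⟩
    z * y                  ∎
    where
    0≤y-x : 0# ≤ y - x
    0≤y-x = begin
      0#       ≈⟨ -‿inverseˡ x ⟨
      - x + x  ≤⟨ +-monoʳ-≤ (- x) x≤y ⟩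
      - x + y  ≈⟨ +-comm _ _ ⟩
      y - x    ∎

  square-nonNeg : ∀ x → 0# ≤ x * x
  square-nonNeg x with total 0# x
  ... | inj₁ 0≤x = *-nonNeg 0≤x 0≤x
  ... | inj₂ x≤0 = begin
    0#         ≤⟨ *-nonNeg 0≤-x 0≤-x ⟩
    - x * - x  ≈⟨ trans (sym (-‿distribˡ-* x (- x))) (-‿cong (sym (-‿distribʳ-* x x))) ⟩
    - - (x * x) ≈⟨ -‿involutive _ ⟩
    x * x      ∎
    where
    0≤-x : 0# ≤ - x
    0≤-x = ≤-trans (≤-reflexive (sym -0#≈0#)) (-‿anti-≤ x≤0)

  0≤1 : 0# ≤ 1#
  0≤1 = ≤-trans (square-nonNeg 1#) (≤-reflexive (*-identityˡ 1#))

  1≰0 : ¬ 1# ≤ 0#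
  1≰0 1≤0 = 0#≉1# (antisym 0≤1 1≤0)

  inverse-nonNeg : ∀ {x y} → 0# ≤ x → x * y ≈ 1# → 0# ≤ y
  inverse-nonNeg {x} {y} 0≤x xy≈1 with total 0# y
  ... | inj₁ 0≤y = 0≤y
  ... | inj₂ y≤0 = ⊥-elim (1≰0 (begin
    1#      ≈⟨ xy≈1 ⟨
    x * y   ≤⟨ *-monoʳ-≤ 0≤x y≤0 ⟩
    x * 0#  ≈⟨ zeroʳ x ⟩
    0#      ∎))

  +-nonNeg-≈0 : ∀ {x y} → 0# ≤ x → 0# ≤ y → x + y ≈ 0# → x ≈ 0#
  +-nonNeg-≈0 0≤x 0≤y x+y≈0 = antisym (≤-trans (x≤x+y 0≤y) (≤-reflexive x+y≈0)) 0≤x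

  square-≈0 : ∀ {x} → x * x ≈ 0# → x ≈ 0#
  square-≈0 {x} xx≈0 with x ≟ 0#
  ... | yes x≈0 = x≈0
  ... | no x≉0 with inverse x x≉0
  ... | y , xy≈1 = begin-equality
    x            ≈⟨ *-identityʳ x ⟨
    x * 1#       ≈⟨ *-congˡ xy≈1 ⟨
    x * (x * y)  ≈⟨ *-assoc x x y ⟨
    x * x * y    ≈⟨ *-congʳ xx≈0 ⟩
    0# * y       ≈⟨ zeroˡ y ⟩
    0#           ∎

  -- Through squares instead of division by two: `x * (x + x)` is a sum of two squares, and such a
  -- sum vanishes only if both do.
  x+x≈0⇒x≈0 : ∀ {x} → x + x ≈ 0# → x ≈ 0#
  x+x≈0⇒x≈0 {x} x+x≈0 = square-≈0
    (+-nonNeg-≈0 (square-nonNeg x) (square-nonNeg x) (begin-equality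
      x * x + x * x  ≈⟨ distribˡ x x x ⟨
      x * (x + x)    ≈⟨ *-congˡ x+x≈0 ⟩
      x * 0#         ≈⟨ zeroʳ x ⟩
      0#             ∎))

  upperBound : ∀ {n} (a : Fin n → Carrier) → ∃[ b ] (∀ i → a i ≤ b)
  upperBound {ℕ.zero}  a = 0# , λ ()
  upperBound {ℕ.suc n} a with upperBound (a ∘ suc)
  ... | b , a≤b with total (a zero) b
  ...   | inj₁ a₀≤b = b , λ { zero → a₀≤b ; (suc i) → a≤b i }
  ...   | inj₂ b≤a₀ = a zero , λ { zero → ≤-refl ; (suc i) → ≤-trans (a≤b i) b≤a₀ }

  sum-cong : ∀ {n} {a b : Fin n → Carrier} → (∀ i → a i ≈ b i) → sum a ≈ sum b
  sum-cong {ℕ.zero}  a≈b = refl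
  sum-cong {ℕ.suc n} a≈b = +-cong (a≈b zero) (sum-cong (a≈b ∘ suc))

  sum-mono-≤ : ∀ {n} {a b : Fin n → Carrier} → (∀ i → a i ≤ b i) → sum a ≤ sum b
  sum-mono-≤ {ℕ.zero}  a≤b = ≤-refl
  sum-mono-≤ {ℕ.suc n} a≤b = +-mono-≤ (a≤b zero) (sum-mono-≤ (a≤b ∘ suc))

  sum-nonNeg : ∀ {n} {a : Fin n → Carrier} → (∀ i → 0# ≤ a i) → 0# ≤ sum a
  sum-nonNeg {ℕ.zero}  0≤a = ≤-refl
  sum-nonNeg {ℕ.suc n} 0≤a = +-nonNeg (0≤a zero) (sum-nonNeg (0≤a ∘ suc))

  sum-≈0 : ∀ {n} {a : Fin n → Carrier} → (∀ i → a i ≈ 0#) → sum a ≈ 0#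
  sum-≈0 {ℕ.zero}  a≈0 = refl
  sum-≈0 {ℕ.suc n} a≈0 = trans (+-cong (a≈0 zero) (sum-≈0 (a≈0 ∘ suc))) (+-identityˡ 0#)

  term≤sum : ∀ {n} {a : Fin n → Carrier} → (∀ i → 0# ≤ a i) → ∀ i → a i ≤ sum a
  term≤sum {ℕ.suc n} 0≤a zero    = x≤x+y (sum-nonNeg (0≤a ∘ suc))
  term≤sum {ℕ.suc n} 0≤a (suc i) = ≤-trans (term≤sum (0≤a ∘ suc) i) (y≤x+y (0≤a zero))

  sum-*ʳ : ∀ {n} (a : Fin n → Carrier) x → sum (λ i → a i * x) ≈ sum a * x
  sum-*ʳ {ℕ.zero}  a x = sym (zeroˡ x)
  sum-*ʳ {ℕ.suc n} a x = trans (+-congˡ (sum-*ʳ (a ∘ suc) x)) (sym (distribʳ x _ _))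

-- Real and complex scalars under one interface

-- The common ground of the two fields on which all later linear algebra rests. `re-*` and
-- `re-definite` concern self-conjugate elements, since squared norms and products `z * conj z` are
-- of this kind. `re-surjective` makes the scalars unbounded and so supplies infinitely many of
-- them.
record ConjugationField (ℝ : CompleteOrderedField) (K : Scalars ℝ) : Set where
  private
    module ℝ = CompleteOrderedField ℝ
  open Scalars K
  field
    1#≉0#           : 1# ≉ 0#
    inverse         : ∀ x → x ≉ 0# → ∃[ y ] x * y ≈ 1#
    conj-+          : ∀ x y → conj (x + y) ≈ conj x + conj y
    conj-*          : ∀ x y → conj (x * y) ≈ conj x * conj y
    conj-involutive : ∀ x → conj (conj x) ≈ x
    re-cong         : ∀ {x y} → x ≈ y → re x ℝ.≈ re y
    re-+            : ∀ x y → re (x + y) ℝ.≈ re x ℝ.+ re y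
    re-*            : ∀ x y → conj x ≈ x → re (x * y) ℝ.≈ re x ℝ.* re y
    re-0#           : re 0# ℝ.≈ ℝ.0#
    re-1#           : re 1# ℝ.≈ ℝ.1#
    re-definite     : ∀ x → conj x ≈ x → re x ℝ.≈ ℝ.0# → x ≈ 0#
    re-surjective   : ∀ a → ∃[ x ] re x ℝ.≈ a
    ∣∣²-nonNeg      : ∀ x → ℝ.0# ℝ.≤ ∣ x ∣²

module _ (ℝ : CompleteOrderedField) where

  private module ℝ = CompleteOrderedField ℝ
  open OrderedField ℝ
  open RingProperties ℝ.ring
  open SemiringSolver ℝ.commutativeSemiring using (solve; _:+_; _:*_; _:=_)

  conjugationField : ∀ 𝕂 → ConjugationField ℝ (scalars ℝ 𝕂)
  conjugationField real = record
    { 1#≉0#           = ℝ.0#≉1# ∘ ℝ.sym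
    ; inverse         = ℝ.inverse
    ; conj-+          = λ _ _ → ℝ.refl
    ; conj-*          = λ _ _ → ℝ.refl
    ; conj-involutive = λ _ → ℝ.refl
    ; re-cong         = λ x≈y → x≈y
    ; re-+            = λ _ _ → ℝ.refl
    ; re-*            = λ _ _ _ → ℝ.refl
    ; re-0#           = ℝ.refl
    ; re-1#           = ℝ.refl
    ; re-definite     = λ _ _ x≈0 → x≈0
    ; re-surjective   = λ a → a , ℝ.refl
    ; ∣∣²-nonNeg      = square-nonNeg
    }
  conjugationField complex = record
    { 1#≉0#           = λ (1≈0 , _) → ℝ.0#≉1# (ℝ.sym 1≈0)
    ; inverse         = inverse
    ; conj-+          = λ (_ , b) (_ , d) → ℝ.refl , ℝ.sym (-‿+-comm b d)
    ; conj-*          = λ (a , b) (c , d) →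
        ℝ.+-congˡ (ℝ.-‿cong (ℝ.sym (-x*-y b d))) ,
        ℝ.trans (ℝ.sym (-‿+-comm (a * d) (b * c)))
                (ℝ.+-cong (-‿distribʳ-* a d) (-‿distribˡ-* b c))
    ; conj-involutive = λ (_ , b) → ℝ.refl , -‿involutive b
    ; re-cong         = proj₁
    ; re-+            = λ _ _ → ℝ.refl
    ; re-*            = λ (a , b) (c , d) (_ , -b≈b) → begin
        a * c - b * d   ≈⟨ ℝ.+-congˡ (ℝ.-‿cong (ℝ.*-congʳ (selfConjugate -b≈b))) ⟩
        a * c - 0# * d  ≈⟨ ℝ.+-congˡ (ℝ.-‿cong (ℝ.zeroˡ d)) ⟩
        a * c - 0#      ≈⟨ ℝ.+-congˡ -0#≈0# ⟩
        a * c + 0#      ≈⟨ ℝ.+-identityʳ _ ⟩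
        a * c           ∎
    ; re-0#           = ℝ.refl
    ; re-1#           = ℝ.refl
    ; re-definite     = λ _ (_ , -b≈b) a≈0 → a≈0 , selfConjugate -b≈b
    ; re-surjective   = λ a → (a , 0#) , ℝ.refl
    ; ∣∣²-nonNeg      = λ (a , b) →
        ≤-trans (+-nonNeg (square-nonNeg a) (square-nonNeg b))
                (≤-reflexive (ℝ.sym (∣∣²-ℂ a b)))
    }
    where
    open ℝ using (_+_; _*_; _-_; -_; 0#; 1#; _≈_)
    open ≈-Reasoning ℝ.setoid
    module C = CommutativeRing (ℂ.commutativeRing ℝ)

    -x*-y : ∀ x y → - x * - y ≈ x * y
    -x*-y x y = begin
      - x * - y      ≈⟨ -‿distribˡ-* x (- y) ⟨
      - (x * - y)    ≈⟨ ℝ.-‿cong (-‿distribʳ-* x y) ⟨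
      - (- (x * y))  ≈⟨ -‿involutive (x * y) ⟩
      x * y          ∎

    selfConjugate : ∀ {b} → - b ≈ b → b ≈ 0#
    selfConjugate {b} -b≈b = x+x≈0⇒x≈0 (begin
      b + b    ≈⟨ ℝ.+-congʳ -b≈b ⟨
      - b + b  ≈⟨ ℝ.-‿inverseˡ b ⟩
      0#       ∎)

    ∣∣²-ℂ : ∀ a b → a * a - b * - b ≈ a * a + b * b
    ∣∣²-ℂ a b = ℝ.+-congˡ (ℝ.trans (-‿distribʳ-* b (- b)) (ℝ.*-congˡ (-‿involutive b)))

    inverse : ∀ x → x C.≉ C.0# → ∃[ y ] (x C.* y) C.≈ C.1#
    inverse (a , b) x≉0 with ℝ.inverse (a * a + b * b) s≉0
      where
      s≉0 : ¬ a * a + b * b ≈ 0#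
      s≉0 s≈0 = x≉0
        ( square-≈0 (+-nonNeg-≈0 (square-nonNeg a) (square-nonNeg b) s≈0)
        , square-≈0 (+-nonNeg-≈0 (square-nonNeg b) (square-nonNeg a)
                      (ℝ.trans (ℝ.+-comm _ _) s≈0)) )
    -- The conjugate divided by the squared modulus; `t` is the inverse of that modulus.
    ... | t , st≈1 = (a * t , - b * t) , (begin
      a * (a * t) - b * (- b * t)
        ≈⟨ ℝ.+-congˡ (ℝ.trans (-‿distribʳ-* b (- b * t)) (ℝ.*-congˡ
             (ℝ.trans (-‿distribˡ-* (- b) t) (ℝ.*-congʳ (-‿involutive b))))) ⟩
      a * (a * t) + b * (b * t)
        ≈⟨ solve 3 (λ a b t → a :* (a :* t) :+ b :* (b :* t) := (a :* a :+ b :* b) :* t)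
             ℝ.refl a b t ⟩
      (a * a + b * b) * t  ≈⟨ st≈1 ⟩
      1# ∎) , (begin
      a * (- b * t) + b * (a * t)
        ≈⟨ solve 4 (λ a b n t → a :* (n :* t) :+ b :* (a :* t) := (n :+ b) :* (a :* t))
             ℝ.refl a b (- b) t ⟩
      (- b + b) * (a * t)  ≈⟨ ℝ.*-congʳ (ℝ.-‿inverseˡ b) ⟩
      0# * (a * t)         ≈⟨ ℝ.zeroˡ _ ⟩
      0#                   ∎)

-- Squared absolute values

module Conjugation {ℝ : CompleteOrderedField} {K : Scalars ℝ} (F : ConjugationField ℝ K) where

  private module ℝ = CompleteOrderedField ℝ
  open Scalars K hiding (zero)
  open ConjugationField F public
  open OrderedField ℝ using (poset; x≤x+y; 1≰0)
  open RawMonoidDefs +-rawMonoid public using (sum)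
  open RingProperties ring public using (-1*x≈-x; -‿distribˡ-*; -‿involutive)

  module ≈ = ≈-Reasoning setoid

  x*y≈0⇒y≈0 : ∀ {x y} → x ≉ 0# → x * y ≈ 0# → y ≈ 0#
  x*y≈0⇒y≈0 {x} {y} x≉0 xy≈0 with inverse x x≉0
  ... | t , xt≈1 = begin
    y            ≈⟨ *-identityˡ y ⟨
    1# * y       ≈⟨ *-congʳ xt≈1 ⟨
    x * t * y    ≈⟨ *-congʳ (*-comm x t) ⟩
    t * x * y    ≈⟨ *-assoc t x y ⟩
    t * (x * y)  ≈⟨ *-congˡ xy≈0 ⟩
    t * 0#       ≈⟨ zeroʳ t ⟩
    0#           ∎
    where open ≈

  x*conj[x]-selfConjugate : ∀ x → conj (x * conj x) ≈ x * conj x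
  x*conj[x]-selfConjugate x = begin
    conj (x * conj x)       ≈⟨ conj-* x (conj x) ⟩
    conj x * conj (conj x)  ≈⟨ *-congˡ (conj-involutive x) ⟩
    conj x * x              ≈⟨ *-comm _ _ ⟩
    x * conj x              ∎
    where open ≈

  ∣∣²-cong : ∀ {x y} → x ≈ y → ∣ x ∣² ℝ.≈ ∣ y ∣²
  ∣∣²-cong x≈y = re-cong (*-cong x≈y (conj-cong x≈y))

  ∣∣²-* : ∀ x y → ∣ x * y ∣² ℝ.≈ ∣ x ∣² ℝ.* ∣ y ∣²
  ∣∣²-* x y = ℝ.trans (re-cong (begin
    x * y * conj (x * y)             ≈⟨ *-congˡ (conj-* x y) ⟩
    x * y * (conj x * conj y)        ≈⟨ solve 4 (λ x y a b → x :* y :* (a :* b) := (x :* a) :* (y :* b))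
                                             refl x y (conj x) (conj y) ⟩
    (x * conj x) * (y * conj y)      ∎))
    (re-* _ _ (x*conj[x]-selfConjugate x))
    where
    open ≈
    open SemiringSolver commutativeSemiring

  ∣∣²-0# : ∀ {x} → x ≈ 0# → ∣ x ∣² ℝ.≈ ℝ.0#
  ∣∣²-0# x≈0 = ℝ.trans (re-cong (trans (*-congʳ x≈0) (zeroˡ _))) re-0#

  -- The parallelogram law with the nonnegative term for `x - y` dropped. The factor two stands in
  -- for the sharp triangle inequality, which would involve square roots; for the existence of frame
  -- bounds any constant is good enough.
  ∣∣²-+-≤ : ∀ x y → ∣ x + y ∣² ℝ.≤ (∣ x ∣² ℝ.+ ∣ x ∣²) ℝ.+ (∣ y ∣² ℝ.+ ∣ y ∣²)
  ∣∣²-+-≤ x y = begin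
    ∣ x + y ∣²                             ≤⟨ x≤x+y (∣∣²-nonNeg (x + - 1# * y)) ⟩
    ∣ x + y ∣² ℝ.+ ∣ x + - 1# * y ∣²       ≈⟨ re-+ _ _ ⟨
    re ((x + y) * conj (x + y) + (x + - 1# * y) * conj (x + - 1# * y))
                                           ≈⟨ re-cong parallelogram ⟩
    re ((x * conj x + x * conj x) + (y * conj y + y * conj y))
                                           ≈⟨ re-+ _ _ ⟩
    re (x * conj x + x * conj x) ℝ.+ re (y * conj y + y * conj y)
                                           ≈⟨ ℝ.+-cong (re-+ _ _) (re-+ _ _) ⟩
    (∣ x ∣² ℝ.+ ∣ x ∣²) ℝ.+ (∣ y ∣² ℝ.+ ∣ y ∣²)  ∎
    where
    open ≤-Reasoning poset
    open SemiringSolver commutativeSemiring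

    conj-[-1] : conj (- 1#) ≈ - 1#
    conj-[-1] = ≈.begin
      conj (- 1#)                          ≈.≈⟨ +-identityʳ _ ⟨
      conj (- 1#) + 0#                     ≈.≈⟨ +-congˡ (-‿inverseʳ 1#) ⟨
      conj (- 1#) + (1# + - 1#)            ≈.≈⟨ +-assoc _ _ _ ⟨
      (conj (- 1#) + 1#) + - 1#            ≈.≈⟨ +-congʳ (+-congˡ conj-1) ⟨
      (conj (- 1#) + conj 1#) + - 1#       ≈.≈⟨ +-congʳ (conj-+ _ _) ⟨
      conj (- 1# + 1#) + - 1#              ≈.≈⟨ +-congʳ (trans (conj-cong (-‿inverseˡ 1#)) conj-0#) ⟩
      0# + - 1#                            ≈.≈⟨ +-identityˡ _ ⟩
      - 1#                                 ≈.∎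
      where
      -- `1# * conj 1#` has the form `x * conj x` and is therefore its own conjugate, while
      -- conjugating `conj 1#` returns `1#`.
      conj-1 : conj 1# ≈ 1#
      conj-1 = ≈.begin
        conj 1#                  ≈.≈⟨ *-identityˡ _ ⟨
        1# * conj 1#             ≈.≈⟨ x*conj[x]-selfConjugate 1# ⟨
        conj (1# * conj 1#)      ≈.≈⟨ conj-cong (*-identityˡ _) ⟩
        conj (conj 1#)           ≈.≈⟨ conj-involutive 1# ⟩
        1#                       ≈.∎

    parallelogram : (x + y) * conj (x + y) + (x + - 1# * y) * conj (x + - 1# * y) ≈
                    (x * conj x + x * conj x) + (y * conj y + y * conj y)
    parallelogram = ≈.begin
      (x + y) * conj (x + y) + (x + - 1# * y) * conj (x + - 1# * y)
        ≈.≈⟨ +-cong (*-congˡ (conj-+ x y)) (*-congˡ (trans (conj-+ _ _)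
              (+-congˡ (trans (conj-* _ _) (*-congʳ conj-[-1]))))) ⟩
      (x + y) * (conj x + conj y) + (x + - 1# * y) * (conj x + - 1# * conj y)
        ≈.≈⟨ solve 5 (λ x y a b n →
              (x :+ y) :* (a :+ b) :+ (x :+ n :* y) :* (a :+ n :* b) :=
              (x :* a :+ x :* a) :+ (y :* b :+ (n :* n) :* (y :* b)) :+
              (n :+ con 1) :* (x :* b :+ y :* a)) refl x y (conj x) (conj y) (- 1#) ⟩
      (x * conj x + x * conj x) + (y * conj y + (- 1# * - 1#) * (y * conj y)) +
      (- 1# + 1#) * (x * conj y + y * conj x)
        ≈.≈⟨ +-cong (+-congˡ (+-congˡ (trans (*-congʳ (trans (-1*x≈-x (- 1#))
              (-‿involutive 1#))) (*-identityˡ _))))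
              (trans (*-congʳ (-‿inverseˡ 1#)) (zeroˡ _)) ⟩
      (x * conj x + x * conj x) + (y * conj y + y * conj y) + 0#
        ≈.≈⟨ +-identityʳ _ ⟩
      (x * conj x + x * conj x) + (y * conj y + y * conj y) ≈.∎

  -- Any t whose real part exceeds that of every b i will do.
  avoid : ∀ {n} (b : Fin n → Carrier) → ∃[ t ] (∀ i → t ≉ b i)
  avoid b with OrderedField.upperBound ℝ (re ∘ b)
  ... | M , re-b≤M with re-surjective (M ℝ.+ ℝ.1#)
  ... | t , re-t≈M+1 = t , λ i t≈bᵢ → 1≰0 (+-cancelˡ-≤ M (begin
    M ℝ.+ ℝ.1#  ≈⟨ ℝ.trans (ℝ.sym re-t≈M+1) (re-cong t≈bᵢ) ⟩
    re (b i)    ≤⟨ re-b≤M i ⟩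
    M           ≈⟨ ℝ.+-identityʳ M ⟨
    M ℝ.+ ℝ.0#  ∎))
    where
    open ≤-Reasoning poset
    +-cancelˡ-≤ : ∀ z {x y} → z ℝ.+ x ℝ.≤ z ℝ.+ y → x ℝ.≤ y
    +-cancelˡ-≤ z {x} {y} zx≤zy = begin
      x                       ≈⟨ cancel x ⟨
      ℝ.- z ℝ.+ (z ℝ.+ x)     ≤⟨ ℝ.+-monoʳ-≤ (ℝ.- z) zx≤zy ⟩
      ℝ.- z ℝ.+ (z ℝ.+ y)     ≈⟨ cancel y ⟩
      y                       ∎
      where
      cancel : ∀ x → ℝ.- z ℝ.+ (z ℝ.+ x) ℝ.≈ x
      cancel x = ℝ.trans (ℝ.sym (ℝ.+-assoc _ _ _))
                         (ℝ.trans (ℝ.+-congʳ (ℝ.-‿inverseˡ z)) (ℝ.+-identityˡ x))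

  re-sum : ∀ {n} (a : Fin n → Carrier) → re (sum a) ℝ.≈ OrderedField.sum ℝ (re ∘ a)
  re-sum {ℕ.zero}  a = re-0#
  re-sum {ℕ.suc n} a = ℝ.trans (re-+ _ _) (ℝ.+-congˡ (re-sum (a ∘ suc)))

-- Linear algebra in an inner product space

module LinearAlgebra {ℝ : CompleteOrderedField} {K : Scalars ℝ} (F : ConjugationField ℝ K)
                     (ℋ : InnerProductSpace ℝ K) where

  private module K = Scalars K
  open K using (_≈_; _≉_; _+_; _*_; -_; 0#; 1#; conj)
  open Conjugation F
  open InnerProductSpace ℋ

  private module ≈ᴹ = ≈-Reasoning ≈ᴹ-setoid
  open CommutativeSemigroupProperties
    (CommutativeMonoid.commutativeSemigroup +ᴹ-commutativeMonoid) using (interchange)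

  *ₗ-negate : ∀ x → x +ᴹ (- 1#) *ₗ x ≈ᴹ 0ᴹ
  *ₗ-negate x = begin
    x +ᴹ (- 1#) *ₗ x        ≈⟨ +ᴹ-congʳ (*ₗ-identityˡ x) ⟨
    1# *ₗ x +ᴹ (- 1#) *ₗ x  ≈⟨ *ₗ-distribʳ x 1# (- 1#) ⟨
    (1# + - 1#) *ₗ x        ≈⟨ *ₗ-congʳ (K.-‿inverseʳ 1#) ⟩
    0# *ₗ x                 ≈⟨ *ₗ-zeroˡ x ⟩
    0ᴹ                      ∎
    where open ≈ᴹ

  infixl 6 _⊖_
  -- Subtraction as addition of the multiple by `- 1#`, so that linearity of the inner product and
  -- closure of spans under scalars apply to it directly.
  _⊖_ : Carrierᴹ → Carrierᴹ → Carrierᴹ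
  x ⊖ y = x +ᴹ (- 1#) *ₗ y

  x≈y+[x⊖y] : ∀ x y → x ≈ᴹ y +ᴹ (x ⊖ y)
  x≈y+[x⊖y] x y = begin
    x                          ≈⟨ +ᴹ-identityʳ x ⟨
    x +ᴹ 0ᴹ                    ≈⟨ +ᴹ-congˡ (*ₗ-negate y) ⟨
    x +ᴹ (y +ᴹ (- 1#) *ₗ y)    ≈⟨ +ᴹ-assoc _ _ _ ⟨
    x +ᴹ y +ᴹ (- 1#) *ₗ y      ≈⟨ +ᴹ-congʳ (+ᴹ-comm x y) ⟩
    y +ᴹ x +ᴹ (- 1#) *ₗ y      ≈⟨ +ᴹ-assoc _ _ _ ⟩
    y +ᴹ (x ⊖ y)               ∎
    where open ≈ᴹ

  x⊖y≈0⇒x≈y : ∀ {x y} → x ⊖ y ≈ᴹ 0ᴹ → x ≈ᴹ y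
  x⊖y≈0⇒x≈y {x} {y} eq = ≈ᴹ-trans (x≈y+[x⊖y] x y) (≈ᴹ-trans (+ᴹ-congˡ eq) (+ᴹ-identityʳ y))

  -- Inner products

  ⟨⟩-+ʳ : ∀ x y z → ⟨ x , y +ᴹ z ⟩ ≈ ⟨ x , y ⟩ + ⟨ x , z ⟩
  ⟨⟩-+ʳ x y z = begin
    ⟨ x , y +ᴹ z ⟩                ≈⟨ ⟨⟩-conj (y +ᴹ z) x ⟩
    conj ⟨ y +ᴹ z , x ⟩           ≈⟨ K.conj-cong (⟨⟩-+ˡ y z x) ⟩
    conj (⟨ y , x ⟩ + ⟨ z , x ⟩)  ≈⟨ conj-+ _ _ ⟩
    conj ⟨ y , x ⟩ + conj ⟨ z , x ⟩ ≈⟨ K.+-cong (⟨⟩-conj y x) (⟨⟩-conj z x) ⟨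
    ⟨ x , y ⟩ + ⟨ x , z ⟩         ∎
    where open ≈

  ⟨⟩-*ʳ : ∀ c x y → ⟨ x , c *ₗ y ⟩ ≈ conj c * ⟨ x , y ⟩
  ⟨⟩-*ʳ c x y = begin
    ⟨ x , c *ₗ y ⟩           ≈⟨ ⟨⟩-conj (c *ₗ y) x ⟩
    conj ⟨ c *ₗ y , x ⟩      ≈⟨ K.conj-cong (⟨⟩-*ˡ c y x) ⟩
    conj (c * ⟨ y , x ⟩)     ≈⟨ conj-* _ _ ⟩
    conj c * conj ⟨ y , x ⟩  ≈⟨ K.*-congˡ (⟨⟩-conj y x) ⟨
    conj c * ⟨ x , y ⟩       ∎
    where open ≈

  ⟨⟩-flip-≈0 : ∀ {x y} → ⟨ x , y ⟩ ≈ 0# → ⟨ y , x ⟩ ≈ 0#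
  ⟨⟩-flip-≈0 {x} {y} eq = K.trans (⟨⟩-conj x y) (K.trans (K.conj-cong eq) K.conj-0#)

  ⟨⟩-0ˡ : ∀ x → ⟨ 0ᴹ , x ⟩ ≈ 0#
  ⟨⟩-0ˡ x = K.trans (⟨⟩-cong (≈ᴹ-sym (*ₗ-zeroˡ 0ᴹ)) ≈ᴹ-refl)
                    (K.trans (⟨⟩-*ˡ 0# 0ᴹ x) (K.zeroˡ _))

  ⟨⟩-0ʳ : ∀ x → ⟨ x , 0ᴹ ⟩ ≈ 0#
  ⟨⟩-0ʳ x = ⟨⟩-flip-≈0 (⟨⟩-0ˡ x)

  ⟨⟩-⊖ˡ-⊥ : ∀ {x y z} → ⟨ y , z ⟩ ≈ 0# → ⟨ x ⊖ y , z ⟩ ≈ ⟨ x , z ⟩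
  ⟨⟩-⊖ˡ-⊥ {x} {y} {z} y⊥z = begin
    ⟨ x ⊖ y , z ⟩                      ≈⟨ ⟨⟩-+ˡ _ _ _ ⟩
    ⟨ x , z ⟩ + ⟨ (- 1#) *ₗ y , z ⟩    ≈⟨ K.+-congˡ (⟨⟩-*ˡ _ _ _) ⟩
    ⟨ x , z ⟩ + - 1# * ⟨ y , z ⟩       ≈⟨ K.+-congˡ (K.trans (K.*-congˡ y⊥z) (K.zeroʳ _)) ⟩
    ⟨ x , z ⟩ + 0#                     ≈⟨ K.+-identityʳ _ ⟩
    ⟨ x , z ⟩                          ∎
    where open ≈

  ⟨⟩-⊖ʳ-⊥ : ∀ {x y z} → ⟨ x , z ⟩ ≈ 0# → ⟨ x , y ⊖ z ⟩ ≈ ⟨ x , y ⟩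
  ⟨⟩-⊖ʳ-⊥ {x} {y} {z} x⊥z = K.trans (⟨⟩-conj _ _) (K.trans
    (K.conj-cong (⟨⟩-⊖ˡ-⊥ (⟨⟩-flip-≈0 x⊥z))) (K.sym (⟨⟩-conj _ _)))

  ⟨⟩-selfConjugate : ∀ x → conj ⟨ x , x ⟩ ≈ ⟨ x , x ⟩
  ⟨⟩-selfConjugate x = K.sym (⟨⟩-conj x x)

  comb : ∀ {n} → (Fin n → K.Carrier) → (Fin n → Carrierᴹ) → Carrierᴹ
  comb c v = sumᴹ (λ k → c k *ₗ v k)

  ⟨⟩-combˡ : ∀ {n} (c : Fin n → K.Carrier) v x → ⟨ comb c v , x ⟩ ≈ sum (λ k → c k * ⟨ v k , x ⟩)
  ⟨⟩-combˡ {ℕ.zero}  c v x = ⟨⟩-0ˡ x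
  ⟨⟩-combˡ {ℕ.suc n} c v x = K.trans (⟨⟩-+ˡ _ _ _)
    (K.+-cong (⟨⟩-*ˡ _ _ _) (⟨⟩-combˡ (c ∘ suc) (v ∘ suc) x))

  -- Spans

  -- Inductive instead of by coefficients: the index type needs no enumeration, and properties of a
  -- span follow by induction on membership. `resp` closes it under the equality of the module.
  data Span {I : Set} (φ : I → Carrierᴹ) : Carrierᴹ → Set where
    gen  : ∀ i → Span φ (φ i)
    zero : Span φ 0ᴹ
    _⊕_  : ∀ {x y} → Span φ x → Span φ y → Span φ (x +ᴹ y)
    _⊙_  : ∀ c {x} → Span φ x → Span φ (c *ₗ x)
    resp : ∀ {x y} → x ≈ᴹ y → Span φ x → Span φ y

  span-⊖ : ∀ {I} {φ : I → Carrierᴹ} {x y} → Span φ x → Span φ y → Span φ (x ⊖ y)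
  span-⊖ p q = p ⊕ ((- 1#) ⊙ q)

  span-⊆ : ∀ {I J} {φ : I → Carrierᴹ} {ψ : J → Carrierᴹ} →
           (∀ i → Span ψ (φ i)) → ∀ {x} → Span φ x → Span ψ x
  span-⊆ φ⊆ψ (gen i)      = φ⊆ψ i
  span-⊆ φ⊆ψ zero         = zero
  span-⊆ φ⊆ψ (p ⊕ q)      = span-⊆ φ⊆ψ p ⊕ span-⊆ φ⊆ψ q
  span-⊆ φ⊆ψ (c ⊙ p)      = c ⊙ span-⊆ φ⊆ψ p
  span-⊆ φ⊆ψ (resp x≈y p) = resp x≈y (span-⊆ φ⊆ψ p)

  span-⊥ : ∀ {I} {φ : I → Carrierᴹ} {y} → (∀ i → ⟨ φ i , y ⟩ ≈ 0#) →
           ∀ {x} → Span φ x → ⟨ x , y ⟩ ≈ 0#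
  span-⊥ φ⊥y (gen i)      = φ⊥y i
  span-⊥ φ⊥y zero         = ⟨⟩-0ˡ _
  span-⊥ φ⊥y (p ⊕ q)      = K.trans (⟨⟩-+ˡ _ _ _)
    (K.trans (K.+-cong (span-⊥ φ⊥y p) (span-⊥ φ⊥y q)) (K.+-identityˡ 0#))
  span-⊥ φ⊥y (c ⊙ p)      = K.trans (⟨⟩-*ˡ _ _ _) (K.trans (K.*-congˡ (span-⊥ φ⊥y p)) (K.zeroʳ c))
  span-⊥ φ⊥y (resp x≈y p) = K.trans (⟨⟩-cong (≈ᴹ-sym x≈y) ≈ᴹ-refl) (span-⊥ φ⊥y p)

  span-⊥-span : ∀ {I J} {φ : I → Carrierᴹ} {ψ : J → Carrierᴹ} →
                (∀ i j → ⟨ φ i , ψ j ⟩ ≈ 0#) →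
                ∀ {x y} → Span φ x → Span ψ y → ⟨ x , y ⟩ ≈ 0#
  span-⊥-span φ⊥ψ p q =
    span-⊥ (λ i → ⟨⟩-flip-≈0 (span-⊥ (λ j → ⟨⟩-flip-≈0 (φ⊥ψ i j)) q)) p

  -- Such an `x` is orthogonal to the whole span, in particular to itself.
  span-⊥⇒≈0 : ∀ {I} {φ : I → Carrierᴹ} {x} → Span φ x → (∀ i → ⟨ φ i , x ⟩ ≈ 0#) → x ≈ᴹ 0ᴹ
  span-⊥⇒≈0 {x = x} p φ⊥x = ⟨⟩-definite x (span-⊥ φ⊥x p)

  span-comb : ∀ {I n} {φ : I → Carrierᴹ} (c : Fin n → K.Carrier) {v : Fin n → Carrierᴹ} →
              (∀ k → Span φ (v k)) → Span φ (comb c v)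
  span-comb {n = ℕ.zero}  c v⊆φ = zero
  span-comb {n = ℕ.suc n} c v⊆φ = (c zero ⊙ v⊆φ zero) ⊕ span-comb (c ∘ suc) (v⊆φ ∘ suc)

  span-reindex : ∀ {I J} (φ : J → Carrierᴹ) (f : I ↔ J) →
                 ∀ {x} → Span φ x → Span (φ ∘ Inverse.to f) x
  span-reindex φ f = span-⊆ λ j →
    ≡.subst (Span (φ ∘ Inverse.to f)) (≡.cong φ (Inverse.strictlyInverseˡ f j)) (gen (Inverse.from f j))

  -- Isolates a coefficient of the first generator. It is not unique when the generators are
  -- dependent; the elimination below works with any choice.
  span-split : ∀ {n} {φ : Fin (ℕ.suc n) → Carrierᴹ} {x} → Span φ x →
               ∃[ a ] ∃[ z ] (Span (φ ∘ suc) z × x ≈ᴹ a *ₗ φ zero +ᴹ z)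
  span-split (gen zero)    = 1# , 0ᴹ , zero ,
    ≈ᴹ-sym (≈ᴹ-trans (+ᴹ-identityʳ _) (*ₗ-identityˡ _))
  span-split (gen (suc i)) = 0# , _ , gen i ,
    ≈ᴹ-sym (≈ᴹ-trans (+ᴹ-congʳ (*ₗ-zeroˡ _)) (+ᴹ-identityˡ _))
  span-split zero          = 0# , 0ᴹ , zero ,
    ≈ᴹ-sym (≈ᴹ-trans (+ᴹ-congʳ (*ₗ-zeroˡ _)) (+ᴹ-identityˡ _))
  span-split {φ = φ} (_⊕_ {x} {y} p q) with span-split p | span-split q
  ... | a , z , z∈ , x≈ | b , w , w∈ , y≈ = a + b , z +ᴹ w , z∈ ⊕ w∈ , (begin
    x +ᴹ y                                        ≈⟨ +ᴹ-cong x≈ y≈ ⟩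
    (a *ₗ φ zero +ᴹ z) +ᴹ (b *ₗ φ zero +ᴹ w)      ≈⟨ interchange _ _ _ _ ⟩
    (a *ₗ φ zero +ᴹ b *ₗ φ zero) +ᴹ (z +ᴹ w)      ≈⟨ +ᴹ-congʳ (*ₗ-distribʳ _ _ _) ⟨
    (a + b) *ₗ φ zero +ᴹ (z +ᴹ w)                 ∎)
    where
    open ≈ᴹ
  span-split {φ = φ} (_⊙_ c {x} p) with span-split p
  ... | a , z , z∈ , x≈ = c * a , c *ₗ z , c ⊙ z∈ , (begin
    c *ₗ x                             ≈⟨ *ₗ-congˡ x≈ ⟩
    c *ₗ (a *ₗ φ zero +ᴹ z)            ≈⟨ *ₗ-distribˡ _ _ _ ⟩
    c *ₗ (a *ₗ φ zero) +ᴹ c *ₗ z       ≈⟨ +ᴹ-congʳ (*ₗ-assoc _ _ _) ⟨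
    (c * a) *ₗ φ zero +ᴹ c *ₗ z        ∎)
    where open ≈ᴹ
  span-split (resp x≈y p) with span-split p
  ... | a , z , z∈ , x≈ = a , z , z∈ , ≈ᴹ-trans (≈ᴹ-sym x≈y) x≈

  span-∅ : ∀ {φ : Fin 0 → Carrierᴹ} {x} → Span φ x → x ≈ᴹ 0ᴹ
  span-∅ p = span-⊥⇒≈0 p λ ()

  span⇒comb : ∀ {n} {φ : Fin n → Carrierᴹ} {x} → Span φ x → ∃[ c ] (x ≈ᴹ comb c φ)
  span⇒comb {ℕ.zero}  p = (λ ()) , span-∅ p
  span⇒comb {ℕ.suc n} p with span-split p
  ... | a , z , z∈ , x≈ with span⇒comb z∈
  ... | c , z≈ = a ∷ c , ≈ᴹ-trans x≈ (+ᴹ-congˡ z≈)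

  -- Dimension

  Spanning : ∀ {I} → (I → Carrierᴹ) → Set
  Spanning φ = ∀ x → Span φ x

  Independent : ∀ {n} → (Fin n → Carrierᴹ) → Set
  Independent v = ∀ c → comb c v ≈ᴹ 0ᴹ → ∀ k → c k ≈ 0#

  -- Gaussian elimination, by induction on the number of generators. If no `v k` involves `w zero`,
  -- that generator is dropped. Otherwise some `v p` serves as pivot: multiples of it clear `w zero`
  -- from the other vectors, leaving one vector fewer and one generator fewer.
  independent⇒≤ : ∀ {s t} {v : Fin s → Carrierᴹ} {w : Fin t → Carrierᴹ} →
                  Independent v → (∀ k → Span w (v k)) → s ℕ.≤ t
  independent⇒≤ {ℕ.zero} v-ind v∈w = ℕ.z≤n
  independent⇒≤ {ℕ.suc s} {ℕ.zero} {v} v-ind v∈w =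
    ⊥-elim (1#≉0# (v-ind (λ _ → 1#) (span-∅ (span-comb (λ _ → 1#) v∈w)) zero))
  independent⇒≤ {ℕ.suc s} {ℕ.suc t} {v} {w} v-ind v∈w
    with Fin.any? (λ k → ¬? (proj₁ (span-split (v∈w k)) K.≟ 0#))
  ... | no ¬∃ = ℕ.m≤n⇒m≤1+n (independent⇒≤ v-ind λ k →
    let (a , z , z∈ , v≈) = span-split (v∈w k)
        a≈0 = decidable-stable (a K.≟ 0#) (λ a≉0 → ¬∃ (k , a≉0))
    in resp (≈ᴹ-sym (≈ᴹ-trans v≈ (≈ᴹ-trans (+ᴹ-congʳ (≈ᴹ-trans (*ₗ-congʳ a≈0) (*ₗ-zeroˡ _)))
                                           (+ᴹ-identityˡ _)))) z∈)
  ... | yes (p , aₚ≉0) = ℕ.s≤s (independent⇒≤ v′-ind v′∈)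
    where
    open ≈ᴹ
    open SumProperties +ᴹ-commutativeMonoid using (sum-remove; sum-cong-≋; ∑-distrib-+)

    a = λ k → proj₁ (span-split (v∈w k))
    z = λ k → proj₁ (proj₂ (span-split (v∈w k)))
    z∈ = λ k → proj₁ (proj₂ (proj₂ (span-split (v∈w k))))
    v≈ = λ k → proj₂ (proj₂ (proj₂ (span-split (v∈w k))))

    b = proj₁ (inverse (a p) aₚ≉0)
    ab≈1 = proj₂ (inverse (a p) aₚ≉0)

    e : Fin s → K.Carrier
    e k = - (a (punchIn p k) * b)

    v′ : Fin s → Carrierᴹ
    v′ k = v (punchIn p k) +ᴹ e k *ₗ v p

    e*aₚ : ∀ k → a (punchIn p k) + e k * a p ≈ 0#
    e*aₚ k = ≈.begin
      a′ + - (a′ * b) * a p    ≈.≈⟨ K.+-congˡ (-‿distribˡ-* _ _) ⟨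
      a′ + - (a′ * b * a p)    ≈.≈⟨ K.+-congˡ (K.-‿cong (K.trans (K.*-assoc _ _ _)
                                   (K.trans (K.*-congˡ (K.trans (K.*-comm _ _) ab≈1)) (K.*-identityʳ _)))) ⟩
      a′ + - a′                ≈.≈⟨ K.-‿inverseʳ a′ ⟩
      0#                       ≈.∎
      where a′ = a (punchIn p k)

    v′∈ : ∀ k → Span (w ∘ suc) (v′ k)
    v′∈ k = resp (begin
      z k′ +ᴹ e k *ₗ z p
        ≈⟨ +ᴹ-identityˡ _ ⟨
      0ᴹ +ᴹ (z k′ +ᴹ e k *ₗ z p)
        ≈⟨ +ᴹ-congʳ (≈ᴹ-trans (*ₗ-congʳ (e*aₚ k)) (*ₗ-zeroˡ _)) ⟨
      (a k′ + e k * a p) *ₗ w zero +ᴹ (z k′ +ᴹ e k *ₗ z p)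
        ≈⟨ +ᴹ-congʳ (≈ᴹ-trans (*ₗ-distribʳ _ _ _) (+ᴹ-congˡ (*ₗ-assoc _ _ _))) ⟩
      (a k′ *ₗ w zero +ᴹ e k *ₗ (a p *ₗ w zero)) +ᴹ (z k′ +ᴹ e k *ₗ z p)
        ≈⟨ interchange _ _ _ _ ⟩
      (a k′ *ₗ w zero +ᴹ z k′) +ᴹ (e k *ₗ (a p *ₗ w zero) +ᴹ e k *ₗ z p)
        ≈⟨ +ᴹ-congˡ (*ₗ-distribˡ _ _ _) ⟨
      (a k′ *ₗ w zero +ᴹ z k′) +ᴹ e k *ₗ (a p *ₗ w zero +ᴹ z p)
        ≈⟨ +ᴹ-cong (v≈ k′) (*ₗ-congˡ (v≈ p)) ⟨
      v′ k ∎) (z∈ k′ ⊕ (e k ⊙ z∈ p))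
      where
      k′ = punchIn p k

    v′-ind : Independent v′
    v′-ind c eq k = K.trans (K.reflexive (≡.sym (Vector.insertAt-punchIn c p c₀ k)))
                            (v-ind C (≈ᴹ-trans lemma eq) (punchIn p k))
      where
      -- The coefficient collected by the pivot when a combination of the `v′ k` is expanded in the
      -- original vectors.
      c₀ = sum (λ k → c k * e k)

      C : Fin (ℕ.suc s) → K.Carrier
      C = insertAt c p c₀

      sum-*ₗ : ∀ {n} (f : Fin n → K.Carrier) x → sum f *ₗ x ≈ᴹ sumᴹ (λ k → f k *ₗ x)
      sum-*ₗ {ℕ.zero}  f x = *ₗ-zeroˡ x
      sum-*ₗ {ℕ.suc n} f x = ≈ᴹ-trans (*ₗ-distribʳ _ _ _) (+ᴹ-congˡ (sum-*ₗ (f ∘ suc) x))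

      lemma : comb C v ≈ᴹ comb c v′
      lemma = begin
        comb C v
          ≈⟨ sum-remove {i = p} (λ k → C k *ₗ v k) ⟩
        C p *ₗ v p +ᴹ sumᴹ (λ k → C (punchIn p k) *ₗ v (punchIn p k))
          ≈⟨ +ᴹ-cong (*ₗ-congʳ (K.reflexive (Vector.insertAt-lookup c p c₀)))
                     (sum-cong-≋ (λ k → *ₗ-congʳ (K.reflexive (Vector.insertAt-punchIn c p c₀ k)))) ⟩
        c₀ *ₗ v p +ᴹ sumᴹ (λ k → c k *ₗ v (punchIn p k))
          ≈⟨ +ᴹ-comm _ _ ⟩
        sumᴹ (λ k → c k *ₗ v (punchIn p k)) +ᴹ c₀ *ₗ v p
          ≈⟨ +ᴹ-congˡ (sum-*ₗ {s} (λ k → c k * e k) (v p)) ⟩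
        sumᴹ (λ k → c k *ₗ v (punchIn p k)) +ᴹ sumᴹ (λ k → (c k * e k) *ₗ v p)
          ≈⟨ ∑-distrib-+ {s} _ _ ⟨
        sumᴹ (λ k → c k *ₗ v (punchIn p k) +ᴹ (c k * e k) *ₗ v p)
          ≈⟨ sum-cong-≋ {s} (λ k → ≈ᴹ-trans (+ᴹ-congˡ (*ₗ-assoc _ _ _)) (≈ᴹ-sym (*ₗ-distribˡ _ _ _))) ⟩
        comb c v′ ∎

  -- Orthogonal families

  -- Nonzero but not normalised, which avoids square roots; inverse squared norms appear as weights
  -- instead.
  record Orthogonal {I : Set} (u : I → Carrierᴹ) : Set where
    field
      perp    : ∀ {k l} → k ≢ l → ⟨ u k , u l ⟩ ≈ 0#
      nonzero : ∀ k → ⟨ u k , u k ⟩ ≉ 0#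

  orthogonal-reindex : ∀ {I J} {u : J → Carrierᴹ} (f : I ↔ J) →
                       Orthogonal u → Orthogonal (u ∘ Inverse.to f)
  orthogonal-reindex f ort = record
    { perp    = λ k≢l → perp (k≢l ∘ Injection.injective (↔⇒↣ f))
    ; nonzero = nonzero ∘ Inverse.to f
    }
    where open Orthogonal ort

  orthogonal-suc : ∀ {n} {u : Fin (ℕ.suc n) → Carrierᴹ} → Orthogonal u → Orthogonal (u ∘ suc)
  orthogonal-suc ort = record
    { perp = λ k≢l → perp (k≢l ∘ Fin.suc-injective) ; nonzero = nonzero ∘ suc }
    where open Orthogonal ort

  ⟨comb,u⟩ : ∀ {n} {u : Fin n → Carrierᴹ} → Orthogonal u → ∀ c j →
             ⟨ comb c u , u j ⟩ ≈ c j * ⟨ u j , u j ⟩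
  ⟨comb,u⟩ {ℕ.suc n} {u} ort c zero = begin
    ⟨ comb c u , u zero ⟩
      ≈⟨ ⟨⟩-+ˡ _ _ _ ⟩
    ⟨ c zero *ₗ u zero , u zero ⟩ + ⟨ comb (c ∘ suc) (u ∘ suc) , u zero ⟩
      ≈⟨ K.+-cong (⟨⟩-*ˡ _ _ _) (span-⊥ {φ = u ∘ suc} (λ i → Orthogonal.perp ort λ ())
                                        (span-comb (c ∘ suc) gen)) ⟩
    c zero * ⟨ u zero , u zero ⟩ + 0#
      ≈⟨ K.+-identityʳ _ ⟩
    c zero * ⟨ u zero , u zero ⟩ ∎
    where open ≈
  ⟨comb,u⟩ {ℕ.suc n} {u} ort c (suc j) = begin
    ⟨ comb c u , u (suc j) ⟩
      ≈⟨ ⟨⟩-+ˡ _ _ _ ⟩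
    ⟨ c zero *ₗ u zero , u (suc j) ⟩ + ⟨ comb (c ∘ suc) (u ∘ suc) , u (suc j) ⟩
      ≈⟨ K.+-cong (K.trans (⟨⟩-*ˡ _ _ _) (K.trans (K.*-congˡ (Orthogonal.perp ort λ ())) (K.zeroʳ _)))
                  (⟨comb,u⟩ (orthogonal-suc ort) (c ∘ suc) j) ⟩
    0# + c (suc j) * ⟨ u (suc j) , u (suc j) ⟩
      ≈⟨ K.+-identityˡ _ ⟩
    c (suc j) * ⟨ u (suc j) , u (suc j) ⟩ ∎
    where open ≈

  orthogonal⇒independent : ∀ {n} {u : Fin n → Carrierᴹ} → Orthogonal u → Independent u
  orthogonal⇒independent {u = u} ort c eq k = x*y≈0⇒y≈0 (nonzero k) (begin
    ⟨ u k , u k ⟩ * c k    ≈⟨ K.*-comm _ _ ⟩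
    c k * ⟨ u k , u k ⟩    ≈⟨ ⟨comb,u⟩ ort c k ⟨
    ⟨ comb c u , u k ⟩     ≈⟨ ⟨⟩-cong eq ≈ᴹ-refl ⟩
    ⟨ 0ᴹ , u k ⟩           ≈⟨ ⟨⟩-0ˡ _ ⟩
    0#                     ∎)
    where
    open Orthogonal ort
    open ≈

  module Projection {n} {u : Fin n → Carrierᴹ} (ort : Orthogonal u) where
    open Orthogonal ort

    weight : Fin n → K.Carrier
    weight k = proj₁ (inverse ⟨ u k , u k ⟩ (nonzero k))

    weight-inverse : ∀ k → ⟨ u k , u k ⟩ * weight k ≈ 1#
    weight-inverse k = proj₂ (inverse ⟨ u k , u k ⟩ (nonzero k))

    coef : Carrierᴹ → Fin n → K.Carrier
    coef x k = ⟨ x , u k ⟩ * weight k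

    proj : Carrierᴹ → Carrierᴹ
    proj x = comb (coef x) u

    proj∈ : ∀ x → Span u (proj x)
    proj∈ x = span-comb (coef x) gen

    ⟨proj,u⟩ : ∀ x k → ⟨ proj x , u k ⟩ ≈ ⟨ x , u k ⟩
    ⟨proj,u⟩ x k = begin
      ⟨ proj x , u k ⟩                             ≈⟨ ⟨comb,u⟩ ort (coef x) k ⟩
      ⟨ x , u k ⟩ * weight k * ⟨ u k , u k ⟩       ≈⟨ K.*-assoc _ _ _ ⟩
      ⟨ x , u k ⟩ * (weight k * ⟨ u k , u k ⟩)     ≈⟨ K.*-congˡ (K.trans (K.*-comm _ _) (weight-inverse k)) ⟩
      ⟨ x , u k ⟩ * 1#                             ≈⟨ K.*-identityʳ _ ⟩
      ⟨ x , u k ⟩                                  ∎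
      where open ≈

    residual-⊥ : ∀ x k → ⟨ u k , x ⊖ proj x ⟩ ≈ 0#
    residual-⊥ x k = ⟨⟩-flip-≈0 (begin
      ⟨ x ⊖ proj x , u k ⟩                              ≈⟨ ⟨⟩-+ˡ _ _ _ ⟩
      ⟨ x , u k ⟩ + ⟨ (- 1#) *ₗ proj x , u k ⟩          ≈⟨ K.+-congˡ (⟨⟩-*ˡ _ _ _) ⟩
      ⟨ x , u k ⟩ + - 1# * ⟨ proj x , u k ⟩             ≈⟨ K.+-congˡ (K.*-congˡ (⟨proj,u⟩ x k)) ⟩
      ⟨ x , u k ⟩ + - 1# * ⟨ x , u k ⟩                  ≈⟨ K.+-congˡ (-1*x≈-x _) ⟩
      ⟨ x , u k ⟩ + - ⟨ x , u k ⟩                       ≈⟨ K.-‿inverseʳ _ ⟩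
      0#                                                ∎)
      where open ≈

    -- The residual lies in the span and is orthogonal to all of it.
    span⇒≈proj : ∀ {x} → Span u x → x ≈ᴹ proj x
    span⇒≈proj {x} x∈ = x⊖y≈0⇒x≈y (span-⊥⇒≈0 (span-⊖ x∈ (proj∈ x)) (residual-⊥ x))

  record OrthogonalBasis {I : Set} (φ : I → Carrierᴹ) : Set where
    field
      size       : ℕ
      basis      : Fin size → Carrierᴹ
      orthogonal : Orthogonal basis
      basis∈     : ∀ k → Span φ (basis k)
      ∈basis     : ∀ i → Span basis (φ i)

  -- The input may be dependent: a vanishing residual contributes nothing, so `size` comes out as
  -- the dimension of the span.
  gramSchmidt : ∀ {n} (φ : Fin n → Carrierᴹ) → OrthogonalBasis φ
  gramSchmidt {ℕ.zero} φ = record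
    { size = 0 ; basis = λ () ; orthogonal = record { perp = λ {k} → λ _ → ⊥-elim (Fin.¬Fin0 k) ; nonzero = λ () }
    ; basis∈ = λ () ; ∈basis = λ () }
  gramSchmidt {ℕ.suc n} φ = extend (⟨ r , r ⟩ K.≟ 0#)
    where
    open OrthogonalBasis (gramSchmidt (φ ∘ suc))
    open Projection orthogonal

    r = φ zero ⊖ proj (φ zero)

    basis∈φ : ∀ k → Span φ (basis k)
    basis∈φ k = span-⊆ (gen ∘ suc) (basis∈ k)

    extend : Dec (⟨ r , r ⟩ ≈ 0#) → OrthogonalBasis φ
    extend (yes r≈0) = record
      { size = size ; basis = basis ; orthogonal = orthogonal ; basis∈ = basis∈φ
      ; ∈basis = λ { zero    → resp (≈ᴹ-sym (x⊖y≈0⇒x≈y (⟨⟩-definite r r≈0))) (proj∈ (φ zero))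
                   ; (suc i) → ∈basis i } }
    extend (no r≉0) = record
      { size = ℕ.suc size ; basis = r ∷ basis
      ; orthogonal = record
        { perp    = λ { {zero}  {zero}  k≢l → ⊥-elim (k≢l ≡.refl)
                      ; {zero}  {suc l} k≢l → ⟨⟩-flip-≈0 (residual-⊥ (φ zero) l)
                      ; {suc k} {zero}  k≢l → residual-⊥ (φ zero) k
                      ; {suc k} {suc l} k≢l → Orthogonal.perp orthogonal (k≢l ∘ ≡.cong suc) }
        ; nonzero = λ { zero → r≉0 ; (suc k) → Orthogonal.nonzero orthogonal k } }
      ; basis∈ = λ { zero    → span-⊖ (gen zero) (span-⊆ basis∈φ (proj∈ (φ zero)))
                   ; (suc k) → basis∈φ k }
      ; ∈basis = λ { zero    → resp (≈ᴹ-sym (x≈y+[x⊖y] (φ zero) (proj (φ zero))))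
                                 (span-⊆ (gen ∘ suc) (proj∈ (φ zero)) ⊕ gen zero)
                   ; (suc i) → span-⊆ (gen ∘ suc) (∈basis i) } }

  orthogonalSpanning⇒dimension : ∀ {I d} {u : I → Carrierᴹ} (f : Fin d ↔ I) →
                                 Orthogonal u → Spanning u → HasDimension d
  orthogonalSpanning⇒dimension {u = u} f ort u-spans = u ∘ Inverse.to f , record
    { linearlyIndependent = orthogonal⇒independent (orthogonal-reindex f ort)
    ; spanning            = λ x → span⇒comb (span-reindex u f (u-spans x))
    }

  orthogonal⇒≤ : ∀ {I d s} {u : I → Carrierᴹ} (f : Fin s ↔ I) → Orthogonal u →
                 HasDimension d → s ℕ.≤ d
  orthogonal⇒≤ {u = u} f ort (e , e-basis) =
    independent⇒≤ (orthogonal⇒independent (orthogonal-reindex f ort)) λ k →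
      let (c , x≈) = IsBasis.spanning e-basis (u (Inverse.to f k))
      in resp (≈ᴹ-sym x≈) (span-comb c gen)

  spanning⇒≥ : ∀ {I d s} {φ : I → Carrierᴹ} (f : Fin s ↔ I) → Spanning φ →
               HasDimension d → d ℕ.≤ s
  spanning⇒≥ {φ = φ} f φ-spans (e , e-basis) =
    independent⇒≤ (IsBasis.linearlyIndependent e-basis) λ k → span-reindex φ f (φ-spans (e k))

  -- Orthogonalising a basis yields a family of a priori unknown size; comparing independent with
  -- spanning families in both directions identifies that size with `d`.
  orthogonalBasis : ∀ {d} → HasDimension d → Σ[ u ∈ (Fin d → Carrierᴹ) ] (Orthogonal u × Spanning u)
  orthogonalBasis {d} (e , e-basis) =
    ≡.subst (λ k → Σ[ u ∈ (Fin k → Carrierᴹ) ] (Orthogonal u × Spanning u))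
            (ℕ.≤-antisym size≤d d≤size)
            (basis , orthogonal , λ x → span-⊆ ∈basis (e-spans x))
    where
    open OrthogonalBasis (gramSchmidt e)

    e-spans : Spanning e
    e-spans x = let (c , x≈) = IsBasis.spanning e-basis x in resp (≈ᴹ-sym x≈) (span-comb c gen)

    size≤d : size ℕ.≤ d
    size≤d = independent⇒≤ (orthogonal⇒independent orthogonal) (λ k → e-spans (basis k))

    d≤size : d ℕ.≤ size
    d≤size = independent⇒≤ (IsBasis.linearlyIndependent e-basis) ∈basis

-- Frames are the spanning sequences

module Frames {ℝ : CompleteOrderedField} {K : Scalars ℝ} (F : ConjugationField ℝ K)
              (ℋ : InnerProductSpace ℝ K) where

  private
    module K = Scalars K
    module ℝ = CompleteOrderedField ℝ
  open K using (_≈_; _≉_; 0#; conj; re; ∣_∣²)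
  open ℝ using ()
    renaming (_≤_ to _≤ʳ_; _+_ to _+ʳ_; _*_ to _*ʳ_; _≈_ to _≈ʳ_; 0# to 0ʳ; 1# to 1ʳ)
  open OrderedField ℝ
  open Conjugation F hiding (sum)
  open InnerProductSpace ℋ
  open LinearAlgebra F ℋ

  -- The vectors with this property form a subspace, so it passes from generators to spans. With the
  -- squared norm as `Q` it produces the upper frame bound, with the frame sum as `Q` the lower one.
  Bounded : (Carrierᴹ → ℝ.Carrier) → Carrierᴹ → Set
  Bounded Q v = ∃[ C ] (0ʳ ≤ʳ C × (∀ f → ∣ ⟨ f , v ⟩ ∣² ≤ʳ C *ʳ Q f))

  span-bounded : ∀ {I} {φ : I → Carrierᴹ} (Q : Carrierᴹ → ℝ.Carrier) →
                 (∀ i → Bounded Q (φ i)) → ∀ {v} → Span φ v → Bounded Q v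
  span-bounded Q φ-bdd (gen i) = φ-bdd i
  span-bounded Q φ-bdd zero    = 0ʳ , ≤-refl , λ f → ≤-reflexive
    (ℝ.trans (∣∣²-0# (⟨⟩-0ʳ f)) (ℝ.sym (ℝ.zeroˡ _)))
  span-bounded Q φ-bdd (_⊕_ {x} {y} p q)
    with span-bounded Q φ-bdd p | span-bounded Q φ-bdd q
  ... | C , 0≤C , bdd-x | D , 0≤D , bdd-y =
    (C +ʳ C) +ʳ (D +ʳ D) , +-nonNeg (+-nonNeg 0≤C 0≤C) (+-nonNeg 0≤D 0≤D) , λ f → begin
      ∣ ⟨ f , x +ᴹ y ⟩ ∣²
        ≈⟨ ∣∣²-cong (⟨⟩-+ʳ f x y) ⟩
      ∣ ⟨ f , x ⟩ K.+ ⟨ f , y ⟩ ∣²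
        ≤⟨ ∣∣²-+-≤ _ _ ⟩
      (∣ ⟨ f , x ⟩ ∣² +ʳ ∣ ⟨ f , x ⟩ ∣²) +ʳ (∣ ⟨ f , y ⟩ ∣² +ʳ ∣ ⟨ f , y ⟩ ∣²)
        ≤⟨ +-mono-≤ (+-mono-≤ (bdd-x f) (bdd-x f)) (+-mono-≤ (bdd-y f) (bdd-y f)) ⟩
      (C *ʳ Q f +ʳ C *ʳ Q f) +ʳ (D *ʳ Q f +ʳ D *ʳ Q f)
        ≈⟨ solve 3 (λ c d q → (c :* q :+ c :* q) :+ (d :* q :+ d :* q) :=
                              ((c :+ c) :+ (d :+ d)) :* q) ℝ.refl C D (Q f) ⟩
      ((C +ʳ C) +ʳ (D +ʳ D)) *ʳ Q f ∎
    where
    open ≤-Reasoning poset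
    open SemiringSolver ℝ.commutativeSemiring using (solve; _:+_; _:*_; _:=_)
  span-bounded Q φ-bdd (_⊙_ c {x} p) with span-bounded Q φ-bdd p
  ... | C , 0≤C , bdd-x = ∣ conj c ∣² *ʳ C , ℝ.*-nonNeg (∣∣²-nonNeg _) 0≤C , λ f → begin
      ∣ ⟨ f , c *ₗ x ⟩ ∣²              ≈⟨ ∣∣²-cong (⟨⟩-*ʳ c f x) ⟩
      ∣ conj c K.* ⟨ f , x ⟩ ∣²        ≈⟨ ∣∣²-* _ _ ⟩
      ∣ conj c ∣² *ʳ ∣ ⟨ f , x ⟩ ∣²    ≤⟨ *-monoʳ-≤ (∣∣²-nonNeg _) (bdd-x f) ⟩
      ∣ conj c ∣² *ʳ (C *ʳ Q f)        ≈⟨ ℝ.*-assoc _ _ _ ⟨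
      ∣ conj c ∣² *ʳ C *ʳ Q f          ∎
    where open ≤-Reasoning poset
  span-bounded Q φ-bdd (resp {x} {y} x≈y p) with span-bounded Q φ-bdd p
  ... | C , 0≤C , bdd-x = C , 0≤C , λ f →
    ≤-trans (≤-reflexive (∣∣²-cong (⟨⟩-cong ≈ᴹ-refl (≈ᴹ-sym x≈y)))) (bdd-x f)

  module Expansion {n} {u : Fin n → Carrierᴹ} (ort : Orthogonal u) (u-spans : Spanning u) where
    open Orthogonal ort
    open Projection ort

    re-weight-inverse : ∀ k → re ⟨ u k , u k ⟩ *ʳ re (weight k) ≈ʳ 1ʳ
    re-weight-inverse k = ℝ.trans (ℝ.sym (re-* _ _ (⟨⟩-selfConjugate (u k))))
                                  (ℝ.trans (re-cong (weight-inverse k)) re-1#)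

    weight-nonNeg : ∀ k → 0ʳ ≤ʳ re (weight k)
    weight-nonNeg k = inverse-nonNeg (⟨⟩-nonNeg (u k)) (re-weight-inverse k)

    -- Parseval's identity for a basis that is not normalised: the real part of `weight k` is the
    -- inverse of the squared norm of `u k`.
    parseval : ∀ f → ∥ f ∥² ≈ʳ sum (λ k → ∣ ⟨ f , u k ⟩ ∣² *ʳ re (weight k))
    parseval f = begin
      re ⟨ f , f ⟩
        ≈⟨ re-cong (⟨⟩-cong (span⇒≈proj (u-spans f)) ≈ᴹ-refl) ⟩
      re ⟨ proj f , f ⟩
        ≈⟨ re-cong (⟨⟩-combˡ (coef f) u f) ⟩
      re (Conjugation.sum F (λ k → coef f k K.* ⟨ u k , f ⟩))
        ≈⟨ re-sum (λ k → coef f k K.* ⟨ u k , f ⟩) ⟩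
      sum (λ k → re (coef f k K.* ⟨ u k , f ⟩))
        ≈⟨ sum-cong (λ k → ℝ.trans (re-cong (term k)) (re-* _ _ (x*conj[x]-selfConjugate _))) ⟩
      sum (λ k → ∣ ⟨ f , u k ⟩ ∣² *ʳ re (weight k)) ∎
      where
      open ≈-Reasoning ℝ.setoid
      term : ∀ k → coef f k K.* ⟨ u k , f ⟩ ≈ (⟨ f , u k ⟩ K.* conj ⟨ f , u k ⟩) K.* weight k
      term k = K.trans (K.*-assoc _ _ _) (K.trans (K.*-congˡ (K.*-comm _ _))
                 (K.trans (K.sym (K.*-assoc _ _ _)) (K.*-congʳ (K.*-congˡ (⟨⟩-conj f (u k))))))

    -- Cauchy-Schwarz for a basis vector, obtained by keeping a single term of Parseval's identity.
    basis-bounded : ∀ k → Bounded ∥_∥² (u k)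
    basis-bounded k = re ⟨ u k , u k ⟩ , ⟨⟩-nonNeg (u k) , λ f → begin
      ∣ ⟨ f , u k ⟩ ∣²
        ≈⟨ ℝ.*-identityʳ _ ⟨
      ∣ ⟨ f , u k ⟩ ∣² *ʳ 1ʳ
        ≈⟨ ℝ.*-congˡ (ℝ.trans (ℝ.*-comm _ _) (re-weight-inverse k)) ⟨
      ∣ ⟨ f , u k ⟩ ∣² *ʳ (re (weight k) *ʳ re ⟨ u k , u k ⟩)
        ≈⟨ ℝ.trans (ℝ.sym (ℝ.*-assoc _ _ _)) (ℝ.*-comm _ _) ⟩
      re ⟨ u k , u k ⟩ *ʳ (∣ ⟨ f , u k ⟩ ∣² *ʳ re (weight k))
        ≤⟨ *-monoʳ-≤ (⟨⟩-nonNeg (u k))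
             (term≤sum (λ k → ℝ.*-nonNeg (∣∣²-nonNeg ⟨ f , u k ⟩) (weight-nonNeg k)) k) ⟩
      re ⟨ u k , u k ⟩ *ʳ sum (λ k → ∣ ⟨ f , u k ⟩ ∣² *ʳ re (weight k))
        ≈⟨ ℝ.*-congˡ (parseval f) ⟨
      re ⟨ u k , u k ⟩ *ʳ ∥ f ∥² ∎
      where open ≤-Reasoning poset

  spanning⇒frame : ∀ {d N} {φ : Fin N → Carrierᴹ} → HasDimension d → Spanning φ → IsFrame φ
  spanning⇒frame {φ = φ} dim φ-spans =
    A , 1ʳ +ʳ D , (0≤A , 0≉A) , A≤1+D , λ f → lower f , upper f
    where
    u = proj₁ (orthogonalBasis dim)
    ort = proj₁ (proj₂ (orthogonalBasis dim))
    u-spans = proj₂ (proj₂ (orthogonalBasis dim))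
    open Projection ort using (weight)
    open Expansion ort u-spans

    S : Carrierᴹ → ℝ.Carrier
    S f = sum (λ i → ∣ ⟨ f , φ i ⟩ ∣²)

    S-nonNeg : ∀ f → 0ʳ ≤ʳ S f
    S-nonNeg f = sum-nonNeg (λ i → ∣∣²-nonNeg ⟨ f , φ i ⟩)

    u-bdd : ∀ k → Bounded S (u k)
    u-bdd k = span-bounded S (λ i → 1ʳ , 0≤1 , λ f →
      ≤-trans (term≤sum (λ i → ∣∣²-nonNeg ⟨ f , φ i ⟩) i) (≤-reflexive (ℝ.sym (ℝ.*-identityˡ _))))
      (φ-spans (u k))

    φ-bdd : ∀ i → Bounded ∥_∥² (φ i)
    φ-bdd i = span-bounded ∥_∥² basis-bounded (u-spans (φ i))

    -- Each basis vector lies in the span of `φ`, so Parseval bounds the squared norm of `f` by `C`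
    -- times `S f`; each `φ i` lies in the span of the basis, so `S f` is at most `D` times the
    -- squared norm. Adding one makes `C` invertible and places the lower bound `A` below the upper
    -- one, even if both constants vanish.
    C = sum (λ k → re (weight k) *ʳ proj₁ (u-bdd k))
    D = sum (λ i → proj₁ (φ-bdd i))

    0≤C : 0ʳ ≤ʳ C
    0≤C = sum-nonNeg (λ k → ℝ.*-nonNeg (weight-nonNeg k) (proj₁ (proj₂ (u-bdd k))))

    0≤D : 0ʳ ≤ʳ D
    0≤D = sum-nonNeg (λ i → proj₁ (proj₂ (φ-bdd i)))

    0≤1+C : 0ʳ ≤ʳ 1ʳ +ʳ C
    0≤1+C = +-nonNeg 0≤1 0≤C

    1+C-inverse : ∃[ A ] (1ʳ +ʳ C) *ʳ A ≈ʳ 1ʳ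
    1+C-inverse = ℝ.inverse (1ʳ +ʳ C) λ 1+C≈0 → 1≰0 (≤-trans (x≤x+y 0≤C) (≤-reflexive 1+C≈0))

    A = proj₁ 1+C-inverse

    0≤A : 0ʳ ≤ʳ A
    0≤A = inverse-nonNeg 0≤1+C (proj₂ 1+C-inverse)

    0≉A : ¬ 0ʳ ≈ʳ A
    0≉A 0≈A = ℝ.0#≉1# (ℝ.trans (ℝ.sym (ℝ.zeroʳ _)) (ℝ.trans (ℝ.*-congˡ 0≈A) (proj₂ 1+C-inverse)))

    A[1+C]≈1 : A *ʳ (1ʳ +ʳ C) ≈ʳ 1ʳ
    A[1+C]≈1 = ℝ.trans (ℝ.*-comm _ _) (proj₂ 1+C-inverse)

    open ≤-Reasoning poset

    A≤1+D : A ≤ʳ 1ʳ +ʳ D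
    A≤1+D = begin
      A                  ≈⟨ ℝ.*-identityʳ A ⟨
      A *ʳ 1ʳ            ≤⟨ *-monoʳ-≤ 0≤A (x≤x+y 0≤C) ⟩
      A *ʳ (1ʳ +ʳ C)     ≈⟨ A[1+C]≈1 ⟩
      1ʳ                 ≤⟨ x≤x+y 0≤D ⟩
      1ʳ +ʳ D            ∎

    lower : ∀ f → A *ʳ ∥ f ∥² ≤ʳ S f
    lower f = begin
      A *ʳ ∥ f ∥²
        ≈⟨ ℝ.*-congˡ (parseval f) ⟩
      A *ʳ sum (λ k → ∣ ⟨ f , u k ⟩ ∣² *ʳ re (weight k))
        ≤⟨ *-monoʳ-≤ 0≤A (sum-mono-≤ term) ⟩
      A *ʳ sum (λ k → re (weight k) *ʳ proj₁ (u-bdd k) *ʳ S f)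
        ≈⟨ ℝ.*-congˡ (sum-*ʳ (λ k → re (weight k) *ʳ proj₁ (u-bdd k)) (S f)) ⟩
      A *ʳ (C *ʳ S f)
        ≤⟨ *-monoʳ-≤ 0≤A (y≤x+y (S-nonNeg f)) ⟩
      A *ʳ (S f +ʳ C *ʳ S f)
        ≈⟨ ℝ.*-congˡ (ℝ.+-congʳ (ℝ.*-identityˡ _)) ⟨
      A *ʳ (1ʳ *ʳ S f +ʳ C *ʳ S f)
        ≈⟨ ℝ.*-congˡ (ℝ.distribʳ _ _ _) ⟨
      A *ʳ ((1ʳ +ʳ C) *ʳ S f)
        ≈⟨ ℝ.*-assoc _ _ _ ⟨
      A *ʳ (1ʳ +ʳ C) *ʳ S f
        ≈⟨ ℝ.trans (ℝ.*-congʳ A[1+C]≈1) (ℝ.*-identityˡ _) ⟩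
      S f ∎
      where
      term : ∀ k → ∣ ⟨ f , u k ⟩ ∣² *ʳ re (weight k) ≤ʳ re (weight k) *ʳ proj₁ (u-bdd k) *ʳ S f
      term k = begin
        ∣ ⟨ f , u k ⟩ ∣² *ʳ re (weight k)           ≈⟨ ℝ.*-comm _ _ ⟩
        re (weight k) *ʳ ∣ ⟨ f , u k ⟩ ∣²           ≤⟨ *-monoʳ-≤ (weight-nonNeg k) (proj₂ (proj₂ (u-bdd k)) f) ⟩
        re (weight k) *ʳ (proj₁ (u-bdd k) *ʳ S f)   ≈⟨ ℝ.*-assoc _ _ _ ⟨
        re (weight k) *ʳ proj₁ (u-bdd k) *ʳ S f     ∎

    upper : ∀ f → S f ≤ʳ (1ʳ +ʳ D) *ʳ ∥ f ∥²
    upper f = begin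
      S f                                          ≤⟨ sum-mono-≤ (λ i → proj₂ (proj₂ (φ-bdd i)) f) ⟩
      sum (λ i → proj₁ (φ-bdd i) *ʳ ∥ f ∥²)        ≈⟨ sum-*ʳ (proj₁ ∘ φ-bdd) ∥ f ∥² ⟩
      D *ʳ ∥ f ∥²                                  ≤⟨ y≤x+y (⟨⟩-nonNeg f) ⟩
      ∥ f ∥² +ʳ D *ʳ ∥ f ∥²                        ≈⟨ ℝ.+-congʳ (ℝ.*-identityˡ _) ⟨
      1ʳ *ʳ ∥ f ∥² +ʳ D *ʳ ∥ f ∥²                  ≈⟨ ℝ.distribʳ _ _ _ ⟨
      (1ʳ +ʳ D) *ʳ ∥ f ∥²                          ∎

  -- The residual of f after projection to the span of the frame is orthogonal
  -- to the frame, so the lower frame bound makes it vanish.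
  frame⇒spanning : ∀ {N} {φ : Fin N → Carrierᴹ} → IsFrame φ → Spanning φ
  frame⇒spanning {φ = φ} (A , _ , (0≤A , 0≉A) , _ , bounds) f =
    span-⊆ basis∈ (resp (≈ᴹ-sym (x⊖y≈0⇒x≈y r≈0)) (proj∈ f))
    where
    open OrthogonalBasis (gramSchmidt φ)
    open Projection orthogonal

    r = f ⊖ proj f

    r⊥φ : ∀ i → ⟨ r , φ i ⟩ ≈ 0#
    r⊥φ i = ⟨⟩-flip-≈0 (span-⊥ (residual-⊥ f) (∈basis i))

    A-inverse : ∃[ t ] A *ʳ t ≈ʳ 1ʳ
    A-inverse = ℝ.inverse A (0≉A ∘ ℝ.sym)

    open ≤-Reasoning poset

    ∥r∥²≤0 : ∥ r ∥² ≤ʳ 0ʳ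
    ∥r∥²≤0 = begin
      ∥ r ∥²                               ≈⟨ ℝ.*-identityˡ _ ⟨
      1ʳ *ʳ ∥ r ∥²                         ≈⟨ ℝ.*-congʳ (ℝ.trans (ℝ.*-comm _ _) (proj₂ A-inverse)) ⟨
      proj₁ A-inverse *ʳ A *ʳ ∥ r ∥²       ≈⟨ ℝ.*-assoc _ _ _ ⟩
      proj₁ A-inverse *ʳ (A *ʳ ∥ r ∥²)     ≤⟨ *-monoʳ-≤ (inverse-nonNeg 0≤A (proj₂ A-inverse)) (proj₁ (bounds r)) ⟩
      proj₁ A-inverse *ʳ sum (λ i → ∣ ⟨ r , φ i ⟩ ∣²)
                                           ≈⟨ ℝ.*-congˡ (sum-≈0 (λ i → ∣∣²-0# (r⊥φ i))) ⟩
      proj₁ A-inverse *ʳ 0ʳ                ≈⟨ ℝ.zeroʳ _ ⟩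
      0ʳ                                   ∎

    r≈0 : r ≈ᴹ 0ᴹ
    r≈0 = ⟨⟩-definite r (re-definite _ (⟨⟩-selfConjugate r) (antisym ∥r∥²≤0 (⟨⟩-nonNeg r)))

-- Representations of graphs by spanning families

module _ {ℝ : CompleteOrderedField} {K : Scalars ℝ} (F : ConjugationField ℝ K) where

  private module K = Scalars K
  open K using (_≉_; 0#)

  -- A frame graph freed from frame bounds and labellings: the vectors are indexed by the vertices
  -- themselves. Only pairs of distinct vertices are constrained, since the norm of a vector carries
  -- no information on adjacency.
  record Representation (d : ℕ) {V : Set} (G : Graph V) : Set₁ where
    field
      space     : InnerProductSpace ℝ K
    open InnerProductSpace space using (Carrierᴹ; ⟨_,_⟩; HasDimension)
    open LinearAlgebra F space using (Spanning)
    field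
      dimension : HasDimension d
      vector    : V → Carrierᴹ
      spanning  : Spanning vector
      adjacent  : ∀ {u v} → u ≢ v → Graph._~_ G u v ⇔ (⟨ vector u , vector v ⟩ ≉ 0#)

  frameGraph⇒representation : ∀ {d V} {G : Graph V} → IsFrameGraph ℝ K d G → Representation d G
  frameGraph⇒representation {G = G} (ℋ , dim , _ , φ , φ-frame , f , f-adj) = record
    { space     = ℋ
    ; dimension = dim
    ; vector    = φ ∘ from
    ; spanning  = λ x → span-⊆ (λ i → ≡.subst (Span (φ ∘ from)) (≡.cong φ (strictlyInverseʳ i)) (gen (to i)))
                          (frame⇒spanning φ-frame x)
    ; adjacent  = λ {u} {v} u≢v → mk⇔
        (λ u~v → proj₂ (Equivalence.from (f-adj (from u) (from v))
          (≡.subst₂ (Graph._~_ G) (≡.sym (strictlyInverseˡ u)) (≡.sym (strictlyInverseˡ v)) u~v)))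
        (λ uv≉0 → ≡.subst₂ (Graph._~_ G) (strictlyInverseˡ u) (strictlyInverseˡ v)
          (Equivalence.to (f-adj (from u) (from v))
            ((λ eq → u≢v (≡.trans (≡.sym (strictlyInverseˡ u))
              (≡.trans (≡.cong to eq) (strictlyInverseˡ v)))) , uv≉0)))
    }
    where
    open Inverse f
    open LinearAlgebra F ℋ
    open Frames F ℋ

  representation⇒frameGraph : ∀ {d N V} {G : Graph V} → Fin N ↔ V →
                              Representation d G → IsFrameGraph ℝ K d G
  representation⇒frameGraph {N = N} {G = G} f ρ =
    space , dimension , N , vector ∘ to ,
    spanning⇒frame dimension (λ x → span-reindex vector f (spanning x)) ,
    f , λ u v → mk⇔
      (λ (u≢v , uv≉0) → Equivalence.from (adjacent (u≢v ∘ Injection.injective (↔⇒↣ f))) uv≉0)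
      (λ u~v → (λ { ≡.refl → Graph.~-irr G u~v }) ,
               Equivalence.to (adjacent λ eq → Graph.~-irr G (≡.subst (Graph._~_ G _) (≡.sym eq) u~v)) u~v)
    where
    open Representation ρ
    open Inverse f
    open LinearAlgebra F space
    open Frames F space

  -- Subspaces

  module Subspace (ℋ : InnerProductSpace ℝ K) {I : Set} (φ : I → InnerProductSpace.Carrierᴹ ℋ) where
    open InnerProductSpace ℋ
    open LinearAlgebra F ℋ

    -- The span as a space in its own right. Elements carry a derivation of membership, and equality
    -- ignores it.
    subspace : InnerProductSpace ℝ K
    subspace = record
      { leftModule = record
        { Carrierᴹ = Σ[ x ∈ Carrierᴹ ] Span φ x
        ; _≈ᴹ_ = λ (x , _) (y , _) → x ≈ᴹ y
        ; _+ᴹ_ = λ (x , p) (y , q) → x +ᴹ y , p ⊕ q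
        ; _*ₗ_ = λ c (x , p) → c *ₗ x , c ⊙ p
        ; 0ᴹ   = 0ᴹ , zero
        ; -ᴹ_  = λ (x , p) → -ᴹ x , resp (-1*x≈-x x) ((K.- K.1#) ⊙ p)
        ; isLeftModule = record
          { isLeftSemimodule = record
            { +ᴹ-isCommutativeMonoid = record
              { isMonoid = record
                { isSemigroup = record
                  { isMagma = record
                    { isEquivalence = record { refl = ≈ᴹ-refl ; sym = ≈ᴹ-sym ; trans = ≈ᴹ-trans }
                    ; ∙-cong = +ᴹ-cong }
                  ; assoc = λ _ _ _ → +ᴹ-assoc _ _ _ }
                ; identity = (λ _ → +ᴹ-identityˡ _) , (λ _ → +ᴹ-identityʳ _) }
              ; comm = λ _ _ → +ᴹ-comm _ _ }
            ; isPreleftSemimodule = record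
              { *ₗ-cong = *ₗ-cong
              ; *ₗ-zeroˡ = λ _ → *ₗ-zeroˡ _
              ; *ₗ-distribʳ = λ _ _ _ → *ₗ-distribʳ _ _ _
              ; *ₗ-identityˡ = λ _ → *ₗ-identityˡ _
              ; *ₗ-assoc = λ _ _ _ → *ₗ-assoc _ _ _
              ; *ₗ-zeroʳ = λ _ → *ₗ-zeroʳ _
              ; *ₗ-distribˡ = λ _ _ _ → *ₗ-distribˡ _ _ _ } }
          ; -ᴹ‿cong = -ᴹ‿cong
          ; -ᴹ‿inverse = (λ _ → -ᴹ‿inverseˡ _) , (λ _ → -ᴹ‿inverseʳ _) } }
      ; ⟨_,_⟩       = λ (x , _) (y , _) → ⟨ x , y ⟩
      ; ⟨⟩-cong     = ⟨⟩-cong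
      ; ⟨⟩-+ˡ       = λ _ _ _ → ⟨⟩-+ˡ _ _ _
      ; ⟨⟩-*ˡ       = λ _ _ _ → ⟨⟩-*ˡ _ _ _
      ; ⟨⟩-conj     = λ _ _ → ⟨⟩-conj _ _
      ; ⟨⟩-nonNeg   = λ _ → ⟨⟩-nonNeg _
      ; ⟨⟩-definite = λ _ → ⟨⟩-definite _
      }
      where
      -1*x≈-x : ∀ x → (K.- K.1#) *ₗ x ≈ᴹ -ᴹ x
      -1*x≈-x x = ≈ᴹ-trans (≈ᴹ-sym (+ᴹ-identityˡ _)) (≈ᴹ-trans (+ᴹ-congʳ (≈ᴹ-sym (-ᴹ‿inverseˡ x)))
        (≈ᴹ-trans (+ᴹ-assoc _ _ _) (≈ᴹ-trans (+ᴹ-congˡ (*ₗ-negate x)) (+ᴹ-identityʳ _))))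

    private module Sub = LinearAlgebra F subspace

    -- The membership proof `x∈` is arbitrary: two elements of the subspace over the same vector are
    -- equal, so `resp` exchanges one derivation for another.
    span-lift : ∀ {J} {ψ : J → Carrierᴹ} (ψ∈ : ∀ j → Span φ (ψ j)) →
                ∀ {x} → Span ψ x → (x∈ : Span φ x) → Sub.Span (λ j → ψ j , ψ∈ j) (x , x∈)
    span-lift ψ∈ (gen i)      x∈ = Sub.resp ≈ᴹ-refl (Sub.gen i)
    span-lift ψ∈ zero         x∈ = Sub.resp ≈ᴹ-refl Sub.zero
    span-lift ψ∈ (p ⊕ q)      x∈ = Sub.resp ≈ᴹ-refl
      (span-lift ψ∈ p (span-⊆ ψ∈ p) Sub.⊕ span-lift ψ∈ q (span-⊆ ψ∈ q))
    span-lift ψ∈ (c ⊙ p)      x∈ = Sub.resp ≈ᴹ-refl (c Sub.⊙ span-lift ψ∈ p (span-⊆ ψ∈ p))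
    span-lift ψ∈ (resp x≈y p) x∈ = Sub.resp x≈y (span-lift ψ∈ p (span-⊆ ψ∈ p))

    spanRepresentation : (basis : OrthogonalBasis φ) {G : Graph I} →
      (∀ {u v} → u ≢ v → Graph._~_ G u v ⇔ (⟨ φ u , φ v ⟩ ≉ 0#)) →
      Representation (OrthogonalBasis.size basis) G
    spanRepresentation B adj = record
      { space     = subspace
      ; dimension = Sub.orthogonalSpanning⇒dimension {u = λ k → basis k , basis∈ k} (↔-id (Fin size))
          (record { perp = perp ; nonzero = nonzero })
          (λ (x , x∈) → span-lift basis∈ (span-⊆ ∈basis x∈) x∈)
      ; vector    = λ i → φ i , gen i
      ; spanning  = λ (x , x∈) → span-lift gen x∈ x∈
      ; adjacent  = adj
      }
      where
      open OrthogonalBasis B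
      open Orthogonal orthogonal

-- Sums of natural numbers

module ℕΣ where
  sum : ∀ {k} → (Fin k → ℕ) → ℕ
  sum = sumOf ℕ.+-0-rawMonoid

  sum-mono-≤ : ∀ {k} {a b : Fin k → ℕ} → (∀ i → a i ℕ.≤ b i) → sum a ℕ.≤ sum b
  sum-mono-≤ {ℕ.zero}  a≤b = ℕ.z≤n
  sum-mono-≤ {ℕ.suc k} a≤b = ℕ.+-mono-≤ (a≤b zero) (sum-mono-≤ (a≤b ∘ suc))

  sum-const : ∀ k c → sum {k} (λ _ → c) ≡ k ℕ.* c
  sum-const ℕ.zero    c = ≡.refl
  sum-const (ℕ.suc k) c = ≡.cong (c ℕ.+_) (sum-const k c)

  Fin-sum↔Σ : ∀ {k} (b : Fin k → ℕ) → Fin (sum b) ↔ (Σ[ i ∈ Fin k ] Fin (b i))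
  Fin-sum↔Σ {ℕ.zero}  b = mk↔ₛ′ (λ ()) (λ ()) (λ ()) (λ ())
  Fin-sum↔Σ {ℕ.suc k} b = split ↔-∘ ((↔-id _ ⊎-↔ Fin-sum↔Σ (b ∘ suc)) ↔-∘ Fin.+↔⊎)
    where
    split : (Fin (b zero) ⊎ (Σ[ i ∈ Fin k ] Fin (b (suc i)))) ↔ (Σ[ i ∈ Fin (ℕ.suc k) ] Fin (b i))
    split = mk↔ₛ′
      (λ { (inj₁ j) → zero , j ; (inj₂ (i , j)) → suc i , j })
      (λ { (zero , j) → inj₁ j ; (suc i , j) → inj₂ (i , j) })
      (λ { (zero , j) → ≡.refl ; (suc i , j) → ≡.refl })
      (λ { (inj₁ j) → ≡.refl ; (inj₂ (i , j)) → ≡.refl })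

  -- Greedy choice: the first entry takes its maximum as long as the others can still be at their
  -- minima; otherwise the others stay at their minima and the first absorbs the remainder.
  sum-between : ∀ {k} (lo hi : Fin k → ℕ) → (∀ i → lo i ℕ.≤ hi i) →
                ∀ {d} → sum lo ℕ.≤ d → d ℕ.≤ sum hi →
                ∃[ b ] ((∀ i → lo i ℕ.≤ b i × b i ℕ.≤ hi i) × sum b ≡ d)
  sum-between {ℕ.zero}  lo hi lo≤hi _ d≤0 = (λ ()) , (λ ()) , ≡.sym (ℕ.n≤0⇒n≡0 d≤0)
  sum-between {ℕ.suc k} lo hi lo≤hi {d} Σlo≤d d≤Σhi with hi zero ℕ.+ sum (lo ∘ suc) ℕ.≤? d
  ... | yes hi₀+Σlo≤d =
    let (b , bounds , Σb≡) = sum-between (lo ∘ suc) (hi ∘ suc) (lo≤hi ∘ suc)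
          (ℕ.m+n≤o⇒m≤o∸n _ (≡.subst (ℕ._≤ d) (ℕ.+-comm (hi zero) _) hi₀+Σlo≤d))
          (ℕ.m≤n+o⇒m∸n≤o d (hi zero) d≤Σhi)
    in hi zero ∷ b ,
       (λ { zero → lo≤hi zero , ℕ.≤-refl ; (suc i) → bounds i }) ,
       ≡.trans (≡.cong (hi zero ℕ.+_) Σb≡) (ℕ.m+[n∸m]≡n (ℕ.m+n≤o⇒m≤o (hi zero) hi₀+Σlo≤d))
  ... | no hi₀+Σlo≰d =
    (d ℕ.∸ sum (lo ∘ suc)) ∷ (lo ∘ suc) ,
    (λ { zero    → ℕ.m+n≤o⇒m≤o∸n (lo zero) Σlo≤d ,
                   ℕ.m≤n+o⇒m∸n≤o d (sum (lo ∘ suc))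
                     (≡.subst (d ℕ.≤_) (ℕ.+-comm (hi zero) _) (ℕ.<⇒≤ (ℕ.≰⇒> hi₀+Σlo≰d)))
       ; (suc i) → ℕ.≤-refl , lo≤hi (suc i) }) ,
    ℕ.m∸n+n≡m (ℕ.m+n≤o⇒n≤o (lo zero) Σlo≤d)

open ℕΣ

-- Counting the vertices of the corona; edges at a vertex

corona-vertices : ∀ n m → Fin (n ℕ.* m ℕ.+ n) ↔ (Fin n ⊎ (Fin n × Fin m))
corona-vertices n m = ⊎-comm _ _ ↔-∘ ((Fin.*↔× {n} {m} ⊎-↔ ↔-id (Fin n)) ↔-∘ Fin.+↔⊎)

-- A walk to a different vertex cannot be empty, and its first edge leaves `u`.
neighbour : ∀ {n} (G : Graph (Fin n)) → 2 ℕ.≤ n → Connected G → ∀ u → ∃[ v ] Graph._~_ G u v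
neighbour {ℕ.suc (ℕ.suc n)} G _ conn u = firstStep (conn u (proj₁ (other u))) (proj₂ (other u))
  where
  other : (u : Fin (ℕ.suc (ℕ.suc n))) → ∃[ v ] u ≢ v
  other zero    = suc zero , λ ()
  other (suc _) = zero , λ ()

  firstStep : ∀ {u v} → Star (Graph._~_ G) u v → u ≢ v → ∃[ w ] Graph._~_ G u w
  firstStep ε         u≢u = ⊥-elim (u≢u ≡.refl)
  firstStep (u~w ◅ _) _   = _ , u~w
neighbour {ℕ.suc ℕ.zero} G (ℕ.s≤s ())

-- Bounds on the dimension of a representation of the corona

module _ {ℝ : CompleteOrderedField} {K : Scalars ℝ} (F : ConjugationField ℝ K) where

  private module K = Scalars K
  open K using (_≈_; _≉_; 0#)

  module RepresentationProperties {d V} {G : Graph V} (ρ : Representation F d G) where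
    open Representation ρ
    open InnerProductSpace space
    open LinearAlgebra F space

    nonadjacent⇒⊥ : ∀ {u v} → u ≢ v → ¬ Graph._~_ G u v → ⟨ vector u , vector v ⟩ ≈ 0#
    nonadjacent⇒⊥ u≢v u≁v = decidable-stable (_ K.≟ _) (u≁v ∘ Equivalence.from (adjacent u≢v))

    adjacent⇒nonzero : ∀ {u v} → Graph._~_ G u v → ⟨ vector u , vector u ⟩ ≉ 0#
    adjacent⇒nonzero {u} {v} u~v u≈0 =
      Equivalence.to (adjacent u≢v) u~v (K.trans (⟨⟩-cong (⟨⟩-definite _ u≈0) ≈ᴹ-refl) (⟨⟩-0ˡ _))
      where
      u≢v : u ≢ v
      u≢v ≡.refl = Graph.~-irr G u~v

  module LowerBound {n m d} {G : Graph (Fin n)} {H : Graph (Fin m)}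
                    (ρ : Representation F d (corona G H)) where
    open Representation ρ
    open RepresentationProperties ρ
    open InnerProductSpace space
    open LinearAlgebra F space

    g : Fin n → Carrierᴹ
    g i = vector (inj₁ i)

    h : Fin n → Fin m → Carrierᴹ
    h i x = vector (inj₂ (i , x))

    h⊥h : ∀ {i j} → i ≢ j → ∀ x y → ⟨ h i x , h j y ⟩ ≈ 0#
    h⊥h i≢j x y = nonadjacent⇒⊥ (λ { ≡.refl → i≢j ≡.refl }) (i≢j ∘ proj₁)

    g⊥h : ∀ {i j} → i ≢ j → ∀ y → ⟨ g i , h j y ⟩ ≈ 0#
    g⊥h i≢j y = nonadjacent⇒⊥ (λ ()) i≢j

    module B (i : Fin n) where
      open OrthogonalBasis (gramSchmidt (h i)) public
      open Projection orthogonal public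

    p : Fin n → Carrierᴹ
    p i = B.proj i (g i)

    g′ : Fin n → Carrierᴹ
    g′ i = g i ⊖ p i

    p∈h : ∀ i → Span (h i) (p i)
    p∈h i = span-⊆ (B.basis∈ i) (B.proj∈ i (g i))

    h⊥p : ∀ {i j} → j ≢ i → ∀ x → ⟨ h j x , p i ⟩ ≈ 0#
    h⊥p {i} j≢i x = ⟨⟩-flip-≈0 (span-⊥ (λ y → h⊥h (j≢i ∘ ≡.sym) y x) (p∈h i))

    -- For `j ≡ i` the residual is orthogonal to the copy by construction; otherwise `g i` and the
    -- subtracted `p i` are each orthogonal to the `j`-th copy.
    h⊥g′ : ∀ j i x → ⟨ h j x , g′ i ⟩ ≈ 0#
    h⊥g′ j i x with j Fin.≟ i
    ... | yes ≡.refl = span-⊥ (B.residual-⊥ i (g i)) (B.∈basis i x)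
    ... | no j≢i     = K.trans (⟨⟩-⊖ʳ-⊥ (h⊥p j≢i x)) (⟨⟩-flip-≈0 (g⊥h (j≢i ∘ ≡.sym) x))

    -- The two projections come off in turn: `p i` is orthogonal to all of `g′ j`, and then `p j` is
    -- orthogonal to `g i`.
    ⟨g′,g′⟩ : ∀ {i j} → i ≢ j → ⟨ g′ i , g′ j ⟩ ≈ ⟨ g i , g j ⟩
    ⟨g′,g′⟩ {i} {j} i≢j = K.trans
      (⟨⟩-⊖ˡ-⊥ (span-⊥ (λ x → h⊥g′ i j x) (p∈h i)))
      (⟨⟩-⊖ʳ-⊥ (⟨⟩-flip-≈0 (span-⊥ (λ x → ⟨⟩-flip-≈0 (g⊥h i≢j x)) (p∈h j))))

    copy : ∀ i → Representation F (B.size i) H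
    copy i = Subspace.spanRepresentation F space (h i) (gramSchmidt (h i)) λ x≢y → mk⇔
      (λ x~y → Equivalence.to (adjacent (λ { ≡.refl → x≢y ≡.refl })) (≡.refl , x~y))
      (λ xy≉0 → proj₂ (Equivalence.from (adjacent (λ { ≡.refl → x≢y ≡.refl })) xy≉0))

    base : Representation F (OrthogonalBasis.size (gramSchmidt g′)) G
    base = Subspace.spanRepresentation F space g′ (gramSchmidt g′) λ {i} {j} i≢j → mk⇔
      (λ i~j eq → Equivalence.to (adjacent (λ { ≡.refl → i≢j ≡.refl })) i~j
                    (K.trans (K.sym (⟨g′,g′⟩ i≢j)) eq))
      (λ ij≉0 → Equivalence.from (adjacent (λ { ≡.refl → i≢j ≡.refl }))
                    (λ eq → ij≉0 (K.trans (⟨g′,g′⟩ i≢j) eq)))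

    module B₀ = OrthogonalBasis (gramSchmidt g′)

    sizes : Fin (ℕ.suc n) → ℕ
    sizes = B₀.size ∷ B.size

    -- The basis for the projected vectors of `G` sits at `zero`, those for the copies of `H` at the
    -- successors. The union is orthogonal, so the total size is at most the dimension of the space.
    union : (Σ[ i ∈ Fin (ℕ.suc n) ] Fin (sizes i)) → Carrierᴹ
    union (zero  , k) = B₀.basis k
    union (suc i , k) = B.basis i k

    union-orthogonal : Orthogonal union
    union-orthogonal = record { perp = λ {k} {l} → perp k l ; nonzero = nonzero }
      where
      nonzero : ∀ k → ⟨ union k , union k ⟩ ≉ 0#
      nonzero (zero  , k) = Orthogonal.nonzero B₀.orthogonal k
      nonzero (suc i , k) = Orthogonal.nonzero (B.orthogonal i) k

      perp : ∀ k l → k ≢ l → ⟨ union k , union l ⟩ ≈ 0#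
      perp (zero  , k) (zero  , l) k≢l = Orthogonal.perp B₀.orthogonal (k≢l ∘ ≡.cong (zero ,_))
      perp (suc i , k) (zero  , l) k≢l = span-⊥-span (λ x l → h⊥g′ i l x) (B.basis∈ i k) (B₀.basis∈ l)
      perp (zero  , k) (suc j , l) k≢l =
        ⟨⟩-flip-≈0 (span-⊥-span (λ y k → h⊥g′ j k y) (B.basis∈ j l) (B₀.basis∈ k))
      perp (suc i , k) (suc j , l) k≢l with i Fin.≟ j
      ... | yes ≡.refl = Orthogonal.perp (B.orthogonal i) (k≢l ∘ ≡.cong (suc i ,_))
      ... | no i≢j     = span-⊥-span (h⊥h i≢j) (B.basis∈ i k) (B.basis∈ j l)

    sum-sizes≤d : sum sizes ℕ.≤ d
    sum-sizes≤d = orthogonal⇒≤ (Fin-sum↔Σ sizes) union-orthogonal dimension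

  -- In dimension zero every vector is an empty combination, hence zero, and a zero vector is
  -- adjacent to nothing. This opens the way to hypotheses about positive dimensions.
  edge⇒1≤dimension : ∀ {d V} {G : Graph V} → Representation F d G →
                     ∀ {u v} → Graph._~_ G u v → 1 ℕ.≤ d
  edge⇒1≤dimension {ℕ.suc d} ρ u~v = ℕ.s≤s ℕ.z≤n
  edge⇒1≤dimension {ℕ.zero} ρ {u} u~v = ⊥-elim (adjacent⇒nonzero u~v
    (K.trans (⟨⟩-cong (proj₂ (spanning (vector u))) ≈ᴹ-refl) (⟨⟩-0ˡ _)))
    where
    open Representation ρ hiding (spanning)
    open RepresentationProperties ρ
    open InnerProductSpace space
    open LinearAlgebra F space
    open IsBasis (proj₂ dimension)

  corona-lowerBound : ∀ {n m d n' m'} {G : Graph (Fin n)} {H : Graph (Fin m)} →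
    2 ℕ.≤ n → 2 ℕ.≤ m → Connected G → Connected H →
    (∀ {r} → 1 ℕ.≤ r → Representation F r G → n' ℕ.≤ r) →
    (∀ {r} → 1 ℕ.≤ r → Representation F r H → m' ℕ.≤ r) →
    Representation F d (corona G H) → n ℕ.* m' ℕ.+ n' ℕ.≤ d
  -- Matching on the inequalities exposes `n` and `m` as successors, so that `zero` is a vertex of
  -- each graph.
  corona-lowerBound {n} {m} {d} {n'} {m'} {G} {H} 2≤n@(ℕ.s≤s _) 2≤m@(ℕ.s≤s _) G-conn H-conn n'≤ m'≤ ρ = begin
    n ℕ.* m' ℕ.+ n'                  ≡⟨ ℕ.+-comm (n ℕ.* m') n' ⟩
    n' ℕ.+ n ℕ.* m'                  ≡⟨ ≡.cong (n' ℕ.+_) (sum-const n m') ⟨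
    n' ℕ.+ sum {n} (λ _ → m')        ≤⟨ ℕ.+-mono-≤ n'≤base (sum-mono-≤ m'≤copy) ⟩
    sum sizes                        ≤⟨ sum-sizes≤d ⟩
    d                                ∎
    where
    open LowerBound ρ

    n'≤base : n' ℕ.≤ B₀.size
    n'≤base = n'≤ (edge⇒1≤dimension base (proj₂ (neighbour G 2≤n G-conn zero))) base

    m'≤copy : ∀ i → m' ℕ.≤ B.size i
    m'≤copy i = m'≤ (edge⇒1≤dimension (copy i) (proj₂ (neighbour H 2≤m H-conn zero))) (copy i)

    open ℕ.≤-Reasoning

  corona-upperBound : ∀ {n m d} {G : Graph (Fin n)} {H : Graph (Fin m)} →
    Representation F d (corona G H) → d ℕ.≤ n ℕ.* m ℕ.+ n
  corona-upperBound {n} {m} ρ = LinearAlgebra.spanning⇒≥ F space (corona-vertices n m) spanning dimension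
    where open Representation ρ

-- Orthogonal direct sums and vectors in general position

open ℕΣ

module _ {ℝ : CompleteOrderedField} {K : Scalars ℝ} (F : ConjugationField ℝ K) where

  private
    module K = Scalars K
    module ℝ = CompleteOrderedField ℝ
  open K using (_≈_; _≉_; 0#)
  open ConjugationField F
  open OrderedField ℝ using (+-nonNeg; +-nonNeg-≈0; ≤-refl; ≤-trans; ≤-reflexive)
  open InnerProductSpace using (Carrierᴹ; HasDimension)

  record Linear (U W : InnerProductSpace ℝ K) (f : Carrierᴹ U → Carrierᴹ W) : Set where
    private
      module U = InnerProductSpace U
      module W = InnerProductSpace W
    field
      map-cong : ∀ {x y} → x U.≈ᴹ y → f x W.≈ᴹ f y
      map-+    : ∀ x y → f (x U.+ᴹ y) W.≈ᴹ f x W.+ᴹ f y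
      map-*    : ∀ c x → f (c U.*ₗ x) W.≈ᴹ c W.*ₗ f x

  span-map : ∀ {U W f} → Linear U W f → ∀ {I} {φ : I → Carrierᴹ U} {x} →
             LinearAlgebra.Span F U φ x → LinearAlgebra.Span F W (f ∘ φ) (f x)
  span-map {U} {W} lin = go
    where
    open Linear lin
    open LinearAlgebra F U
    module LW = LinearAlgebra F W
    module U = InnerProductSpace U
    module W = InnerProductSpace W

    go : ∀ {I} {φ : I → Carrierᴹ U} {x} → Span φ x → LW.Span _ _
    go (gen i)      = LW.gen i
    go zero         = LW.resp (W.≈ᴹ-trans (W.≈ᴹ-sym (W.*ₗ-zeroˡ _))
                        (W.≈ᴹ-trans (W.≈ᴹ-sym (map-* 0# U.0ᴹ)) (map-cong (U.*ₗ-zeroˡ _)))) LW.zero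
    go (p ⊕ q)      = LW.resp (W.≈ᴹ-sym (map-+ _ _)) (go p LW.⊕ go q)
    go (c ⊙ p)      = LW.resp (W.≈ᴹ-sym (map-* c _)) (c LW.⊙ go p)
    go (resp x≈y p) = LW.resp (map-cong x≈y) (go p)

  -- Direct sums

  trivial : InnerProductSpace ℝ K
  trivial = record
    { leftModule  = Zero.leftModule
    ; ⟨_,_⟩       = λ _ _ → 0#
    ; ⟨⟩-cong     = λ _ _ → K.refl
    ; ⟨⟩-+ˡ       = λ _ _ _ → K.sym (K.+-identityˡ 0#)
    ; ⟨⟩-*ˡ       = λ c _ _ → K.sym (K.zeroʳ c)
    ; ⟨⟩-conj     = λ _ _ → K.sym K.conj-0#
    ; ⟨⟩-nonNeg   = λ _ → ≤-reflexive (ℝ.sym re-0#)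
    ; ⟨⟩-definite = λ _ _ → _
    }

  infixr 6 _⊞_

  _⊞_ : InnerProductSpace ℝ K → InnerProductSpace ℝ K → InnerProductSpace ℝ K
  U ⊞ W = record
    { leftModule  = DirectProduct.leftModule U.leftModule W.leftModule
    ; ⟨_,_⟩       = λ (x , x′) (y , y′) → U.⟨ x , y ⟩ K.+ W.⟨ x′ , y′ ⟩
    ; ⟨⟩-cong     = λ (p , p′) (q , q′) → K.+-cong (U.⟨⟩-cong p q) (W.⟨⟩-cong p′ q′)
    ; ⟨⟩-+ˡ       = λ (x , x′) (y , y′) (z , z′) →
        K.trans (K.+-cong (U.⟨⟩-+ˡ x y z) (W.⟨⟩-+ˡ x′ y′ z′)) (interchange _ _ _ _)
    ; ⟨⟩-*ˡ       = λ c (x , x′) (y , y′) →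
        K.trans (K.+-cong (U.⟨⟩-*ˡ c x y) (W.⟨⟩-*ˡ c x′ y′)) (K.sym (K.distribˡ _ _ _))
    ; ⟨⟩-conj     = λ (x , x′) (y , y′) →
        K.trans (K.+-cong (U.⟨⟩-conj x y) (W.⟨⟩-conj x′ y′)) (K.sym (conj-+ _ _))
    ; ⟨⟩-nonNeg   = λ (x , x′) →
        ≤-trans (+-nonNeg (U.⟨⟩-nonNeg x) (W.⟨⟩-nonNeg x′)) (≤-reflexive (ℝ.sym (re-+ _ _)))
    -- Both squared norms have nonnegative real part, so a vanishing sum makes each real part
    -- vanish; being self-conjugate, the norms are then zero themselves.
    ; ⟨⟩-definite = λ (x , x′) eq →
        U.⟨⟩-definite x (re-definite _ (K.sym (U.⟨⟩-conj x x))
          (+-nonNeg-≈0 (U.⟨⟩-nonNeg x) (W.⟨⟩-nonNeg x′) (re-≈0 eq))) ,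
        W.⟨⟩-definite x′ (re-definite _ (K.sym (W.⟨⟩-conj x′ x′))
          (+-nonNeg-≈0 (W.⟨⟩-nonNeg x′) (U.⟨⟩-nonNeg x) (ℝ.trans (ℝ.+-comm _ _) (re-≈0 eq))))
    }
    where
    module U = InnerProductSpace U
    module W = InnerProductSpace W
    open CommutativeSemigroupProperties K.+-commutativeSemigroup using (interchange)

    re-≈0 : ∀ {a b} → a K.+ b ≈ 0# → K.re a ℝ.+ K.re b ℝ.≈ ℝ.0#
    re-≈0 eq = ℝ.trans (ℝ.sym (re-+ _ _)) (ℝ.trans (re-cong eq) re-0#)

  ⨁ : ∀ {k} → (Fin k → InnerProductSpace ℝ K) → InnerProductSpace ℝ K
  ⨁ {ℕ.zero}  ℋ = trivial
  ⨁ {ℕ.suc k} ℋ = ℋ zero ⊞ ⨁ (ℋ ∘ suc)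

  inj : ∀ {k} (ℋ : Fin k → InnerProductSpace ℝ K) i → Carrierᴹ (ℋ i) → Carrierᴹ (⨁ ℋ)
  inj ℋ zero    x = x , InnerProductSpace.0ᴹ (⨁ (ℋ ∘ suc))
  inj ℋ (suc i) x = InnerProductSpace.0ᴹ (ℋ zero) , inj (ℋ ∘ suc) i x

  inj₀-linear : ∀ U W → Linear U (U ⊞ W) (_, InnerProductSpace.0ᴹ W)
  inj₀-linear U W = record
    { map-cong = _, W.≈ᴹ-refl
    ; map-+    = λ _ _ → U.≈ᴹ-refl , W.≈ᴹ-sym (W.+ᴹ-identityˡ _)
    ; map-*    = λ c _ → U.≈ᴹ-refl , W.≈ᴹ-sym (W.*ₗ-zeroʳ c)
    }
    where
    module U = InnerProductSpace U
    module W = InnerProductSpace W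

  inj₁-linear : ∀ U W → Linear W (U ⊞ W) (InnerProductSpace.0ᴹ U ,_)
  inj₁-linear U W = record
    { map-cong = U.≈ᴹ-refl ,_
    ; map-+    = λ _ _ → U.≈ᴹ-sym (U.+ᴹ-identityˡ _) , W.≈ᴹ-refl
    ; map-*    = λ c _ → U.≈ᴹ-sym (U.*ₗ-zeroʳ c) , W.≈ᴹ-refl
    }
    where
    module U = InnerProductSpace U
    module W = InnerProductSpace W

  linear-∘ : ∀ {U V W f g} → Linear V W g → Linear U V f → Linear U W (g ∘ f)
  linear-∘ {W = W} g-lin f-lin = record
    { map-cong = g.map-cong ∘ f.map-cong
    ; map-+    = λ x y → ≈ᴹ-trans (g.map-cong (f.map-+ x y)) (g.map-+ _ _)
    ; map-*    = λ c x → ≈ᴹ-trans (g.map-cong (f.map-* c x)) (g.map-* c _)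
    }
    where
    module f = Linear f-lin
    module g = Linear g-lin
    open InnerProductSpace W using (≈ᴹ-trans)

  inj-linear : ∀ {k} (ℋ : Fin k → InnerProductSpace ℝ K) i → Linear (ℋ i) (⨁ ℋ) (inj ℋ i)
  inj-linear ℋ zero    = inj₀-linear (ℋ zero) (⨁ (ℋ ∘ suc))
  inj-linear ℋ (suc i) =
    linear-∘ (inj₁-linear (ℋ zero) (⨁ (ℋ ∘ suc))) (inj-linear (ℋ ∘ suc) i)

  ⟨inj,inj⟩ : ∀ {k} (ℋ : Fin k → InnerProductSpace ℝ K) i x y →
              InnerProductSpace.⟨_,_⟩ (⨁ ℋ) (inj ℋ i x) (inj ℋ i y) ≈
              InnerProductSpace.⟨_,_⟩ (ℋ i) x y
  ⟨inj,inj⟩ ℋ zero    x y = K.trans (K.+-congˡ (LinearAlgebra.⟨⟩-0ˡ F (⨁ (ℋ ∘ suc)) _)) (K.+-identityʳ _)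
  ⟨inj,inj⟩ ℋ (suc i) x y = K.trans
    (K.+-cong (LinearAlgebra.⟨⟩-0ˡ F (ℋ zero) _) (⟨inj,inj⟩ (ℋ ∘ suc) i x y)) (K.+-identityˡ _)

  inj⊥inj : ∀ {k} (ℋ : Fin k → InnerProductSpace ℝ K) {i j} → i ≢ j → ∀ x y →
            InnerProductSpace.⟨_,_⟩ (⨁ ℋ) (inj ℋ i x) (inj ℋ j y) ≈ 0#
  inj⊥inj ℋ {zero}  {zero}  i≢j x y = ⊥-elim (i≢j ≡.refl)
  inj⊥inj ℋ {zero}  {suc j} i≢j x y = K.trans
    (K.+-cong (LinearAlgebra.⟨⟩-0ʳ F (ℋ zero) x) (LinearAlgebra.⟨⟩-0ˡ F (⨁ (ℋ ∘ suc)) _))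
    (K.+-identityˡ 0#)
  inj⊥inj ℋ {suc i} {zero}  i≢j x y = K.trans
    (K.+-cong (LinearAlgebra.⟨⟩-0ˡ F (ℋ zero) y) (LinearAlgebra.⟨⟩-0ʳ F (⨁ (ℋ ∘ suc)) _))
    (K.+-identityˡ 0#)
  inj⊥inj ℋ {suc i} {suc j} i≢j x y = K.trans
    (K.+-cong (LinearAlgebra.⟨⟩-0ˡ F (ℋ zero) _) (inj⊥inj (ℋ ∘ suc) (i≢j ∘ ≡.cong suc) x y))
    (K.+-identityˡ 0#)

  inj-spanning : ∀ {k} (ℋ : Fin k → InnerProductSpace ℝ K) →
                 LinearAlgebra.Spanning F (⨁ ℋ) (uncurry (inj ℋ))
  inj-spanning {ℕ.zero}  ℋ _       = LinearAlgebra.resp _ (LinearAlgebra.zero {F = F} {ℋ = trivial})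
  inj-spanning {ℕ.suc k} ℋ (x , y) =
    resp (ℋ₀.+ᴹ-identityʳ x , ℋ₊.+ᴹ-identityˡ y)
      (gen (zero , x) ⊕ span-⊆ (λ (i , z) → gen (suc i , z))
        (span-map (inj₁-linear (ℋ zero) (⨁ (ℋ ∘ suc))) (inj-spanning (ℋ ∘ suc) y)))
    where
    open LinearAlgebra F (⨁ ℋ)
    module ℋ₀ = InnerProductSpace (ℋ zero)
    module ℋ₊ = InnerProductSpace (⨁ (ℋ ∘ suc))

  -- The family `ψ` may be indexed independently of the summands; it only has to reach the injected
  -- generators. The corrected vectors, which straddle two summands, call for this generality.
  ⨁-spanning : ∀ {k} (ℋ : Fin k → InnerProductSpace ℝ K) {J} {ψ : J → Carrierᴹ (⨁ ℋ)}
    {I : Fin k → Set} (φ : ∀ i → I i → Carrierᴹ (ℋ i)) →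
    (∀ i → LinearAlgebra.Spanning F (ℋ i) (φ i)) →
    (∀ i j → LinearAlgebra.Span F (⨁ ℋ) ψ (inj ℋ i (φ i j))) →
    LinearAlgebra.Spanning F (⨁ ℋ) ψ
  ⨁-spanning ℋ φ φ-spans φ⊆ψ x = span-⊆
    (λ (i , y) → span-⊆ (φ⊆ψ i) (span-map (inj-linear ℋ i) (φ-spans i y)))
    (inj-spanning ℋ x)
    where open LinearAlgebra F (⨁ ℋ)

  ⨁-dimension : ∀ {k} (ℋ : Fin k → InnerProductSpace ℝ K) {b : Fin k → ℕ} →
                (∀ i → HasDimension (ℋ i) (b i)) → HasDimension (⨁ ℋ) (sum b)
  ⨁-dimension {k} ℋ {b} dims =
    orthogonalSpanning⇒dimension (Fin-sum↔Σ b)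
      (record { perp = λ {x} {y} → perp x y ; nonzero = nonzero })
      (⨁-spanning ℋ u (λ i → proj₂ (proj₂ (B i))) (λ i j → gen (i , j)))
    where
    open LinearAlgebra F (⨁ ℋ)
    open InnerProductSpace (⨁ ℋ) using (⟨_,_⟩)

    B = λ i → LinearAlgebra.orthogonalBasis F (ℋ i) (dims i)

    u : ∀ i → Fin (b i) → Carrierᴹ (ℋ i)
    u i = proj₁ (B i)

    module O (i : Fin k) = LinearAlgebra.Orthogonal (proj₁ (proj₂ (B i)))

    v : (Σ[ i ∈ Fin k ] Fin (b i)) → Carrierᴹ (⨁ ℋ)
    v (i , j) = inj ℋ i (u i j)

    nonzero : ∀ x → ⟨ v x , v x ⟩ ≉ 0#
    nonzero (i , j) eq = O.nonzero i j (K.trans (K.sym (⟨inj,inj⟩ ℋ i _ _)) eq)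

    perp : ∀ x y → x ≢ y → ⟨ v x , v y ⟩ ≈ 0#
    perp (i , j) (i′ , j′) x≢y with i Fin.≟ i′
    ... | yes ≡.refl = K.trans (⟨inj,inj⟩ ℋ i _ _) (O.perp i (x≢y ∘ ≡.cong (i ,_)))
    ... | no i≢i′    = inj⊥inj ℋ i≢i′ _ _

  -- A polynomial of degree at most one that is not identically zero has at most one root. If `b`
  -- vanishes it has none, and `0#` is a placeholder.
  root : ∀ a b → ¬ (a ≈ 0# × b ≈ 0#) → ∃[ s ] (∀ t → a K.+ t K.* b ≈ 0# → t ≈ s)
  root a b ¬0 with b K.≟ 0#
  ... | yes b≈0 = 0# , λ t eq → ⊥-elim (¬0 (K.trans (K.sym (K.trans
        (K.+-congˡ (K.trans (K.*-congˡ b≈0) (K.zeroʳ t))) (K.+-identityʳ a))) eq , b≈0))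
  ... | no b≉0 with inverse b b≉0
  ... | s , bs≈1 = K.- a K.* s , λ t eq → begin
    t                    ≈⟨ K.*-identityʳ t ⟨
    t K.* K.1#           ≈⟨ K.*-congˡ bs≈1 ⟨
    t K.* (b K.* s)      ≈⟨ K.*-assoc _ _ _ ⟨
    t K.* b K.* s        ≈⟨ K.*-congʳ (+-inverseʳ-unique a _ eq) ⟩
    K.- a K.* s          ∎
    where
    open ≈-Reasoning K.setoid
    open RingProperties K.ring using (+-inverseʳ-unique)

  module _ (ℋ : InnerProductSpace ℝ K) where
    open InnerProductSpace ℋ hiding (Carrierᴹ)
    open LinearAlgebra F ℋ

    -- On the line v + t h₀ each of the finitely many conditions excludes at
    -- most one value of t.
    generic : ∀ {n} (h : Fin n → Carrierᴹ ℋ) → (∀ x → ⟨ h x , h x ⟩ ≉ 0#) →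
              ∃[ v ] (∀ x → ⟨ v , h x ⟩ ≉ 0#)
    generic {ℕ.zero}  h h≉0 = 0ᴹ , λ ()
    generic {ℕ.suc n} h h≉0 = v +ᴹ t *ₗ h zero , λ x eq → t≉s x (proj₂ (s x) t (K.trans (K.sym (expand x)) eq))
      where
      v = proj₁ (generic (h ∘ suc) (h≉0 ∘ suc))

      -- At `zero` the direction of the line is `h zero` itself, whose norm is nonzero; at the other
      -- indices the constant term is nonzero by induction.
      not-both-0 : ∀ x → ¬ (⟨ v , h x ⟩ ≈ 0# × ⟨ h zero , h x ⟩ ≈ 0#)
      not-both-0 zero    (_ , eq) = h≉0 zero eq
      not-both-0 (suc x) (eq , _) = proj₂ (generic (h ∘ suc) (h≉0 ∘ suc)) x eq

      s = λ x → root ⟨ v , h x ⟩ ⟨ h zero , h x ⟩ (not-both-0 x)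
      t = proj₁ (Conjugation.avoid F (proj₁ ∘ s))
      t≉s = proj₂ (Conjugation.avoid F (proj₁ ∘ s))

      expand : ∀ x → ⟨ v +ᴹ t *ₗ h zero , h x ⟩ ≈ ⟨ v , h x ⟩ K.+ t K.* ⟨ h zero , h x ⟩
      expand x = K.trans (⟨⟩-+ˡ _ _ _) (K.+-congˡ (⟨⟩-*ˡ _ _ _))

  -- A representation of the corona from representations of its parts

  module Construction {n m} {G : Graph (Fin n)} {H : Graph (Fin m)} (b : Fin (ℕ.suc n) → ℕ)
    (ρ : Representation F (b zero) G) (σ : ∀ i → Representation F (b (suc i)) H)
    (H-neighbour : ∀ x → ∃[ y ] Graph._~_ H x y) where

    module ρ = Representation ρ
    module σ i = Representation (σ i)
    module S i = InnerProductSpace (σ.space i)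

    summand : Fin (ℕ.suc n) → InnerProductSpace ℝ K
    summand zero    = ρ.space
    summand (suc i) = σ.space i

    summand-dimension : ∀ i → HasDimension (summand i) (b i)
    summand-dimension zero    = ρ.dimension
    summand-dimension (suc i) = σ.dimension i

    ℋ : InnerProductSpace ℝ K
    ℋ = ⨁ summand

    open InnerProductSpace ℋ hiding (Carrierᴹ; HasDimension)
    open LinearAlgebra F ℋ

    -- A neighbour in `H` forces each vector of the frame to be nonzero, as general position
    -- requires.
    apex : ∀ i → ∃[ c ] (∀ x → S.⟨_,_⟩ i c (σ.vector i x) ≉ 0#)
    apex i = generic (σ.space i) (σ.vector i)
      (λ x → RepresentationProperties.adjacent⇒nonzero F (σ i) (proj₂ (H-neighbour x)))

    g⁰ : Fin n → Carrierᴹ ℋ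
    g⁰ i = inj summand zero (ρ.vector i)

    c : Fin n → Carrierᴹ ℋ
    c i = inj summand (suc i) (proj₁ (apex i))

    h : Fin n → Fin m → Carrierᴹ ℋ
    h i x = inj summand (suc i) (σ.vector i x)

    ψ : Fin n ⊎ (Fin n × Fin m) → Carrierᴹ ℋ
    ψ (inj₁ i)       = g⁰ i +ᴹ c i
    ψ (inj₂ (i , x)) = h i x

    suc-≢ : ∀ {i j : Fin n} → i ≢ j → Fin.suc i ≢ suc j
    suc-≢ i≢j = i≢j ∘ Fin.suc-injective

    -- Apart from the product of the two vectors for `G`, every term pairs vectors of different
    -- summands; for the corrections `c i` and `c j` this is where `i ≢ j` enters.
    ⟨ψ₁,ψ₁⟩ : ∀ {i j} → i ≢ j →
              ⟨ ψ (inj₁ i) , ψ (inj₁ j) ⟩ ≈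
              InnerProductSpace.⟨_,_⟩ ρ.space (ρ.vector i) (ρ.vector j)
    ⟨ψ₁,ψ₁⟩ {i} {j} i≢j = begin
      ⟨ g⁰ i +ᴹ c i , g⁰ j +ᴹ c j ⟩
        ≈⟨ ⟨⟩-+ˡ _ _ _ ⟩
      ⟨ g⁰ i , g⁰ j +ᴹ c j ⟩ K.+ ⟨ c i , g⁰ j +ᴹ c j ⟩
        ≈⟨ K.+-cong (⟨⟩-+ʳ _ _ _) (⟨⟩-+ʳ _ _ _) ⟩
      (⟨ g⁰ i , g⁰ j ⟩ K.+ ⟨ g⁰ i , c j ⟩) K.+ (⟨ c i , g⁰ j ⟩ K.+ ⟨ c i , c j ⟩)
        ≈⟨ K.+-cong (K.+-cong (⟨inj,inj⟩ summand zero _ _) (inj⊥inj summand {zero} {suc j} (λ ()) _ _))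
                    (K.+-cong (inj⊥inj summand {suc i} {zero} (λ ()) _ _) (inj⊥inj summand (suc-≢ i≢j) _ _)) ⟩
      (_ K.+ 0#) K.+ (0# K.+ 0#)
        ≈⟨ K.+-cong (K.+-identityʳ _) (K.+-identityˡ _) ⟩
      _ K.+ 0#
        ≈⟨ K.+-identityʳ _ ⟩
      InnerProductSpace.⟨_,_⟩ ρ.space (ρ.vector i) (ρ.vector j) ∎
      where open ≈-Reasoning K.setoid

    ⟨ψ₁,ψ₂⟩ : ∀ i j x → ⟨ ψ (inj₁ i) , ψ (inj₂ (j , x)) ⟩ ≈ ⟨ c i , h j x ⟩
    ⟨ψ₁,ψ₂⟩ i j x = K.trans (⟨⟩-+ˡ _ _ _) (K.trans
      (K.+-congʳ (inj⊥inj summand {zero} {suc j} (λ ()) _ _)) (K.+-identityˡ _))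

    adjacent₁₂ : ∀ i j x → (i ≡ j) ⇔ (⟨ ψ (inj₁ i) , ψ (inj₂ (j , x)) ⟩ ≉ 0#)
    adjacent₁₂ i j x = mk⇔
      (λ { ≡.refl eq → proj₂ (apex i) x
             (K.trans (K.sym (⟨inj,inj⟩ summand (suc i) _ _)) (K.trans (K.sym (⟨ψ₁,ψ₂⟩ i i x)) eq)) })
      from
      where
      from : ⟨ ψ (inj₁ i) , ψ (inj₂ (j , x)) ⟩ ≉ 0# → i ≡ j
      from ≉0 with i Fin.≟ j
      ... | yes i≡j = i≡j
      ... | no i≢j  = ⊥-elim (≉0 (K.trans (⟨ψ₁,ψ₂⟩ i j x) (inj⊥inj summand (suc-≢ i≢j) _ _)))

    ψ-adjacent : ∀ u v → u ≢ v → Graph._~_ (corona G H) u v ⇔ (⟨ ψ u , ψ v ⟩ ≉ 0#)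
    ψ-adjacent (inj₁ i) (inj₁ j) u≢v = mk⇔
      (λ i~j eq → Equivalence.to (ρ.adjacent i≢j) i~j (K.trans (K.sym (⟨ψ₁,ψ₁⟩ i≢j)) eq))
      (λ ≉0 → Equivalence.from (ρ.adjacent i≢j) (λ eq → ≉0 (K.trans (⟨ψ₁,ψ₁⟩ i≢j) eq)))
      where
      i≢j : i ≢ j
      i≢j = u≢v ∘ ≡.cong inj₁
    ψ-adjacent (inj₁ i) (inj₂ (j , x)) _ = adjacent₁₂ i j x
    ψ-adjacent (inj₂ (i , x)) (inj₁ j) _ = mk⇔
      (λ i≡j eq → Equivalence.to (adjacent₁₂ j i x) (≡.sym i≡j) (⟨⟩-flip-≈0 eq))
      (λ ≉0 → ≡.sym (Equivalence.from (adjacent₁₂ j i x) (λ eq → ≉0 (⟨⟩-flip-≈0 eq))))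
    ψ-adjacent (inj₂ (i , x)) (inj₂ (j , y)) u≢v with i Fin.≟ j
    ... | no i≢j     = mk⇔ (λ (i≡j , _) → ⊥-elim (i≢j i≡j))
                           (λ ≉0 → ⊥-elim (≉0 (inj⊥inj summand (suc-≢ i≢j) _ _)))
    ... | yes ≡.refl = mk⇔
      (λ (_ , x~y) eq → Equivalence.to (σ.adjacent i x≢y) x~y
                          (K.trans (K.sym (⟨inj,inj⟩ summand (suc i) _ _)) eq))
      (λ ≉0 → ≡.refl , Equivalence.from (σ.adjacent i x≢y)
                          (λ eq → ≉0 (K.trans (⟨inj,inj⟩ summand (suc i) _ _) eq)))
      where
      x≢y : x ≢ y
      x≢y = u≢v ∘ ≡.cong (λ z → inj₂ (i , z))

    Index : Fin (ℕ.suc n) → Set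
    Index zero    = Fin n
    Index (suc _) = Fin m

    frame : ∀ i → Index i → Carrierᴹ (summand i)
    frame zero    = ρ.vector
    frame (suc i) = σ.vector i

    frame-spanning : ∀ i → LinearAlgebra.Spanning F (summand i) (frame i)
    frame-spanning zero    = ρ.spanning
    frame-spanning (suc i) = σ.spanning i

    -- The correction `c i` belongs to a summand spanned by the vectors `h i x`, all of which occur
    -- in `ψ`; subtracting it recovers `g⁰ i`.
    frame⊆ψ : ∀ i j → Span ψ (inj summand i (frame i j))
    frame⊆ψ zero    i = resp [g+c]⊖c≈g (span-⊖ (gen (inj₁ i)) c∈ψ)
      where
      c∈ψ : Span ψ (c i)
      c∈ψ = span-⊆ (λ x → gen (inj₂ (i , x)))
                   (span-map (inj-linear summand (suc i)) (σ.spanning i (proj₁ (apex i))))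

      [g+c]⊖c≈g : (g⁰ i +ᴹ c i) ⊖ c i ≈ᴹ g⁰ i
      [g+c]⊖c≈g = ≈ᴹ-trans (+ᴹ-assoc _ _ _) (≈ᴹ-trans (+ᴹ-congˡ (*ₗ-negate (c i))) (+ᴹ-identityʳ _))
    frame⊆ψ (suc i) x = gen (inj₂ (i , x))

    coronaRepresentation : Representation F (sum b) (corona G H)
    coronaRepresentation = record
      { space     = ℋ
      ; dimension = ⨁-dimension summand summand-dimension
      ; vector    = ψ
      ; spanning  = ⨁-spanning summand frame frame-spanning frame⊆ψ
      ; adjacent  = λ {u} {v} → ψ-adjacent u v
      }

-- Both directions for every field and dimension

open import Data.Nat.Base using (_+_; _*_; _≤_)

theorem3p14 :
    (ℝ : CompleteOrderedField)
    (n m : ℕ) → 2 ≤ n → 2 ≤ m →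
    (G : Graph (Fin n)) (H : Graph (Fin m)) →
    Connected G → Connected H →
    Chordal G ⊎ IsCycle G → Chordal H ⊎ IsCycle H →
    (n' m' : ℕ) →
    IsJustFrameGraph ℝ G n' n → IsJustFrameGraph ℝ H m' m →
    IsJustFrameGraph ℝ (corona G H) (n * m' + n') (n * m + n)
theorem3p14 ℝ n m 2≤n 2≤m G H G-conn H-conn _ _ n' m' (1≤n' , n'≤n , G-just) (1≤m' , m'≤m , H-just) =
  ℕ.≤-trans 1≤n' (ℕ.m≤n+m n' (n * m')) ,
  ℕ.+-mono-≤ (ℕ.*-monoʳ-≤ n m'≤m) n'≤n ,
  λ 𝕂 d _ → mk⇔ (bounds 𝕂 d) (exists 𝕂 d)
  where
  bounds : ∀ 𝕂 d → IsFrameGraph ℝ (scalars ℝ 𝕂) d (corona G H) → n * m' + n' ≤ d × d ≤ n * m + n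
  bounds 𝕂 d fg =
    corona-lowerBound F 2≤n 2≤m G-conn H-conn
      (λ {r} 1≤r ρ → proj₁ (Equivalence.to (G-just 𝕂 r 1≤r) (representation⇒frameGraph F (↔-id _) ρ)))
      (λ {r} 1≤r ρ → proj₁ (Equivalence.to (H-just 𝕂 r 1≤r) (representation⇒frameGraph F (↔-id _) ρ)))
      ρ₀ ,
    corona-upperBound F ρ₀
    where
    F = conjugationField ℝ 𝕂
    ρ₀ = frameGraph⇒representation F fg

  exists : ∀ 𝕂 d → n * m' + n' ≤ d × d ≤ n * m + n → IsFrameGraph ℝ (scalars ℝ 𝕂) d (corona G H)
  exists 𝕂 d (lo≤d , d≤hi) = representation⇒frameGraph F (corona-vertices n m)
    (≡.subst (λ d → Representation F d (corona G H)) (proj₂ (proj₂ between))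
      (Construction.coronaRepresentation F b
        (representation G-just 1≤n' (b-bounds zero))
        (λ i → representation H-just 1≤m' (b-bounds (suc i)))
        (neighbour H 2≤m H-conn)))
    where
    F = conjugationField ℝ 𝕂

    representation : ∀ {k a c e} {J : Graph (Fin k)} →
      (∀ 𝕂 d → 1 ≤ d → IsFrameGraph ℝ (scalars ℝ 𝕂) d J ⇔ (a ≤ d × d ≤ c)) →
      1 ≤ a → a ≤ e × e ≤ c → Representation F e J
    representation {e = e} just 1≤a (a≤e , e≤c) =
      frameGraph⇒representation F (Equivalence.from (just 𝕂 e (ℕ.≤-trans 1≤a a≤e)) (a≤e , e≤c))

    -- Admissible ranges: entry `zero` for the dimension given to `G`, one further entry for each
    -- copy of `H`. The prescribed `d` is then split into admissible dimensions.
    lo hi : Fin (ℕ.suc n) → ℕ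
    lo = n' ∷ λ _ → m'
    hi = n ∷ λ _ → m

    Σ≡ : ∀ a c → a + sum {n} (λ _ → c) ≡ n * c + a
    Σ≡ a c = ≡.trans (≡.cong (a +_) (sum-const n c)) (ℕ.+-comm a (n * c))

    between = sum-between lo hi (λ { zero → n'≤n ; (suc _) → m'≤m })
      (≡.subst (_≤ d) (≡.sym (Σ≡ n' m')) lo≤d)
      (≡.subst (d ≤_) (≡.sym (Σ≡ n m)) d≤hi)
    b = proj₁ between

    b-bounds : ∀ i → lo i ≤ b i × b i ≤ hi i
    b-bounds = proj₁ (proj₂ between)
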